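{- For every $3$-edge-connected graph $G$, the Frank number satisfies $F(G)\le 5$. That is, there exist five strongly connected orientations $O_1,\dots,O_5$ of $G$ such that for every edge $e$ of $G$ there is some $i\in\{1,\dots,5\}$ for which the arc of $O_i$ corresponding to $e$ is deletable in $O_i$.
   Context: Graphs are finite, without loops or multiple edges. An orientation of a graph $G=(V,E)$ is a directed graph obtained by replacing each edge $uv$ by exactly one of the arcs $(u,v)$ or $(v,u)$. A directed graph is strongly connected if for any two vertices $x,y$ there is a directed path from $x$ to $y$. In an orientation $O$ of $G$, an arc $e$ is deletable if $O-e$ (the orientation with arc $e$ removed) is strongly connected. For a $3$-edge-connected graph $G$, the Frank number $F(G)$ is the minimum $k$ such that $G$ admits $k$ strongly connected orientations with the property that for every edge $e$ of $G$ the corresponding arc is deletable in at least one of the $k$ orientations. -}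

module Defs where

open import Data.Nat using (ℕ; _≤_)
open import Data.Fin using (Fin)
open import Data.Bool using (Bool; true; false)
open import Data.Product using (_×_; _,_; proj₁; proj₂; Σ; ∃-syntax)
open import Data.List using (List; length)
open import Data.List.Membership.Propositional using (_∈_)
open import Relation.Binary.PropositionalEquality using (_≡_; _≢_)
open import Relation.Nullary using (¬_)
open import Data.Sum using (_⊎_)

record Graph : Set where
  field
    n     : ℕ
    m     : ℕ
    ends  : Fin m → Fin n × Fin n
    loopless : ∀ i → proj₁ (ends i) ≢ proj₂ (ends i)
    simple : ∀ i j →
      (proj₁ (ends i) ≡ proj₁ (ends j) × proj₂ (ends i) ≡ proj₂ (ends j)) ⊎
      (proj₁ (ends i) ≡ proj₂ (ends j) × proj₂ (ends i) ≡ proj₁ (ends j)) →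
      i ≡ j
open Graph public

data UReach (G : Graph) (present : Fin (m G) → Set) : Fin (n G) → Fin (n G) → Set where
  here : ∀ {x} → UReach G present x x
  fwd  : ∀ {y z} (e : Fin (m G)) → present e → proj₁ (ends G e) ≡ y →
         UReach G present (proj₂ (ends G e)) z → UReach G present y z
  bwd  : ∀ {y z} (e : Fin (m G)) → present e → proj₂ (ends G e) ≡ y →
         UReach G present (proj₁ (ends G e)) z → UReach G present y z

EdgeConnected : ℕ → Graph → Set
EdgeConnected k G =
  ∀ (F : List (Fin (m G))) → Data.Nat._<_ (length F) k →
  ∀ x y → UReach G (λ e → ¬ (e ∈ F)) x y

Orientation : Graph → Set
Orientation G = Fin (m G) → Bool

tail head : (G : Graph) → Orientation G → Fin (m G) → Fin (n G)
tail G O e with O e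
... | true  = proj₁ (ends G e)
... | false = proj₂ (ends G e)
head G O e with O e
... | true  = proj₂ (ends G e)
... | false = proj₁ (ends G e)

data DReach (G : Graph) (O : Orientation G) (present : Fin (m G) → Set)
     : Fin (n G) → Fin (n G) → Set where
  here : ∀ {x} → DReach G O present x x
  step : ∀ {y z} (e : Fin (m G)) → present e → tail G O e ≡ y →
         DReach G O present (head G O e) z → DReach G O present y z

AllArcs : (G : Graph) → Fin (m G) → Set
AllArcs G e = e ≡ e

StronglyConnected : (G : Graph) → Orientation G → Set
StronglyConnected G O = ∀ x y → DReach G O (AllArcs G) x y

Deletable : (G : Graph) → Orientation G → Fin (m G) → Set
Deletable G O e = ∀ x y → DReach G O (λ f → f ≢ e) x y

FrankNumber≤ : Graph → ℕ → Set
FrankNumber≤ G k =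
  Σ (Fin k → Orientation G) λ Os →
    (∀ i → StronglyConnected G (Os i)) ×
    (∀ e → ∃[ i ] Deletable G (Os i) e)

{-# OPTIONS --safe #-}

-- In an orientation along a positive integer flow every cut has as much flow going out as coming
-- in. Hence a nowhere-zero flow gives a strongly connected orientation, and in a 3-edge-connected
-- graph an arc of value 1 is deletable: alone in its direction across a cut it would face at least
-- two arcs of total value 1. It remains to find five nowhere-zero integer flows such that every
-- edge has value 1 or -1 in one of them.
--
-- As in Seymour's 6-flow theorem, grow a vertex set U by ears: two edges f₁, f₂ from U to a
-- connected even subgraph C of G - U. This yields an integer flow φ with values 1 or -1 on the union
-- of the subgraphs C and 0 elsewhere, while the remaining edges come in pairs, each pair closed by a
-- circuit through earlier edges. Adjusting a flow along these circuits in reverse order, one can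
-- make the first edges ±1 and the second ones nonzero, or vice versa, or all of them nonzero modulo
-- 3. Adding a large multiple of φ to the first two results gives two of the five flows. The third
-- reduces modulo 3 to a flow g with |g| ≤ 2, and 3φ + 2g, 3φ - 2g, φ + 2g take care of the support
-- of φ.
module Submission where

open import Defs
open import Algebra.Bundles using (CommutativeRing)
open import Data.Bool using (true; false)
open import Data.Empty using (⊥; ⊥-elim)
open import Data.Fin using (Fin; zero; suc)
open import Data.Fin.Patterns using (0F; 1F; 2F; 3F; 4F)
open import Data.Fin.Properties using (any?) renaming (_≟_ to _≟ᶠ_)
open import Data.Fin.Subset using (Subset; _∈_; _∉_; _∪_; _─_; _⊂_; _⊃_; ∁; ⁅_⁆)
open import Data.Fin.Subset.Induction using (⊂-wellFounded; ⊃-wellFounded)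
open import Data.Fin.Subset.Properties
  using ( _∈?_; p⊆p∪q; q⊆p∪q; x∈p∪q⁻; x∈p∩q⁺; x∈⁅x⁆; x∈⁅y⁆⇒x≡y; x∉p⇒x∈∁p; x∈∁p⇒x∉p
        ; x∈p∧x∉q⇒x∈p─q; p─q⊆p; p∩q≢∅⇒p─q⊂p)
open import Data.Integer hiding (suc)
open import Data.Integer.Divisibility.Signed using (_∣_; _∣?_; divides; ∣m∣n⇒∣m-n; ∣m+n∣m⇒∣n)
open import Data.Integer.Properties
open import Data.Integer.Tactic.RingSolver using (solve-∀)
open import Data.List using (List; []; _∷_; allFin; length)
open import Data.List.Membership.Propositional using () renaming (_∈_ to _∈ˡ_)
open import Data.List.Membership.Propositional.Properties using (∈-allFin)
open import Data.List.Relation.Unary.Any using (here; there)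
open import Data.Nat as ℕ using (ℕ; s≤s; z≤n)
open import Data.Nat.Induction using (<-wellFounded)
import Data.Nat.Properties as ℕ
open import Data.Product using (_×_; _,_; proj₁; proj₂; Σ; ∃)
open import Data.Sum using (_⊎_; inj₁; inj₂; [_,_]′)
open import Data.Unit using (⊤; tt)
open import Data.Vec using (_∷_; here; there)
open import Function using (_∘_)
open import Induction.WellFounded using (Acc; acc)
open import Relation.Binary.Construct.Closure.ReflexiveTransitive using (Star; ε; _◅_; _◅◅_)
open import Relation.Binary.Definitions using (tri<; tri≈; tri>)
open import Relation.Binary.PropositionalEquality
open import Relation.Nullary using (¬_; Dec; yes; no; contradiction)
open import Relation.Nullary.Decidable using (_×-dec_; _⊎-dec_; ¬?; ⌊_⌋; from-no; decidable-stable)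
open import Algebra.Properties.Semiring.Sum (CommutativeRing.semiring +-*-commutativeRing)
  using (sum; sum-cong-≗; ∑-distrib-+; *-distribˡ-sum)
import Algebra.Properties.Monoid.Sum ℕ.+-0-monoid as ℕΣ

-- Kronecker deltas, sums of integers, and indicator functions.

δ : ∀ {k} → Fin k → Fin k → ℤ
δ zero    zero    = 1ℤ
δ zero    (suc _) = 0ℤ
δ (suc _) zero    = 0ℤ
δ (suc i) (suc j) = δ i j

δ-refl : ∀ {k} (i : Fin k) → δ i i ≡ 1ℤ
δ-refl zero    = refl
δ-refl (suc i) = δ-refl i

δ-≢ : ∀ {k} {i j : Fin k} → i ≢ j → δ i j ≡ 0ℤ
δ-≢ {i = zero}  {zero}  i≢j = contradiction refl i≢j
δ-≢ {i = zero}  {suc _} i≢j = refl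
δ-≢ {i = suc _} {zero}  i≢j = refl
δ-≢ {i = suc _} {suc _} i≢j = δ-≢ (i≢j ∘ cong suc)

sum-zero : ∀ {k} (f : Fin k → ℤ) → (∀ i → f i ≡ 0ℤ) → sum f ≡ 0ℤ
sum-zero {ℕ.zero}  f f≡0 = refl
sum-zero {ℕ.suc k} f f≡0 = cong₂ _+_ (f≡0 zero) (sum-zero (f ∘ suc) (f≡0 ∘ suc))

sum-δ : ∀ {k} (i : Fin k) (f : Fin k → ℤ) → sum (λ j → δ i j * f j) ≡ f i
sum-δ zero f = trans
  (cong₂ _+_ (*-identityˡ (f zero)) (sum-zero (λ j → 0ℤ * f (suc j)) (λ j → *-zeroˡ (f (suc j)))))
  (+-identityʳ (f zero))
sum-δ (suc i) f = trans (+-identityˡ _) (sum-δ i (f ∘ suc))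

sum-δ-1 : ∀ {k} (i : Fin k) → sum (δ i) ≡ 1ℤ
sum-δ-1 i = trans (sum-cong-≗ (λ j → sym (*-identityʳ (δ i j)))) (sum-δ i (λ _ → 1ℤ))

sum-mono : ∀ {k} (f g : Fin k → ℤ) → (∀ i → f i ≤ g i) → sum f ≤ sum g
sum-mono {ℕ.zero}  f g f≤g = ≤-refl
sum-mono {ℕ.suc k} f g f≤g = +-mono-≤ (f≤g zero) (sum-mono (f ∘ suc) (g ∘ suc) (f≤g ∘ suc))

Unit Small : ℤ → Set
Unit z  = z ≡ 1ℤ ⊎ z ≡ -1ℤ
Small z = z ≡ 0ℤ ⊎ Unit z

neg-unit : ∀ {z} → Unit z → Unit (- z)
neg-unit (inj₁ refl) = inj₂ refl
neg-unit (inj₂ refl) = inj₁ refl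

-- Used as a potential: the pairing of a chain with `ind S` is its net flow into `S`, so cut
-- arguments become instances of conservation.
ind : ∀ {k} → Subset k → Fin k → ℤ
ind S v with v ∈? S
... | yes _ = 1ℤ
... | no  _ = 0ℤ

ind-∈ : ∀ {k} {S : Subset k} {v} → v ∈ S → ind S v ≡ 1ℤ
ind-∈ {S = S} {v} v∈S with v ∈? S
... | yes _  = refl
... | no v∉S = contradiction v∈S v∉S

ind-∉ : ∀ {k} {S : Subset k} {v} → v ∉ S → ind S v ≡ 0ℤ
ind-∉ {S = S} {v} v∉S with v ∈? S
... | yes v∈S = contradiction v∈S v∉S
... | no _    = refl

-- Integer chains, flows, and the walks found by reachability search.

module Chains (G : Graph) where

  V E : Set
  V = Fin (n G)
  E = Fin (m G)

  src tgt : E → V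
  src e = proj₁ (ends G e)
  tgt e = proj₂ (ends G e)

  Chain : Set
  Chain = E → ℤ

  infixl 6 _⊕_
  infixl 7 _⊙_

  _⊕_ : Chain → Chain → Chain
  (f ⊕ g) e = f e + g e

  _⊙_ : ℤ → Chain → Chain
  (c ⊙ f) e = c * f e

  diff : (V → ℤ) → E → ℤ
  diff π e = π (tgt e) - π (src e)

  ⟪_,_⟫ : Chain → (V → ℤ) → ℤ
  ⟪ w , π ⟫ = sum (λ e → w e * diff π e)

  -- Summation by parts turns conservation at the vertices into orthogonality to all potential
  -- differences; in this form the unit flow along a walk telescopes.
  record Bdry (w : Chain) (x y : V) : Set where
    constructor bdry
    field telescope : ∀ π → ⟪ w , π ⟫ ≡ π y - π x
  open Bdry public

  record Flow (w : Chain) : Set where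
    constructor flow
    field conserved : ∀ π → ⟪ w , π ⟫ ≡ 0ℤ
  open Flow public

  ⟪⟫-⊕ : ∀ f g π → ⟪ f ⊕ g , π ⟫ ≡ ⟪ f , π ⟫ + ⟪ g , π ⟫
  ⟪⟫-⊕ f g π = trans (sum-cong-≗ (λ e → *-distribʳ-+ (diff π e) (f e) (g e))) (∑-distrib-+ (λ e → f e * diff π e) (λ e → g e * diff π e))

  ⟪⟫-⊙ : ∀ c f π → ⟪ c ⊙ f , π ⟫ ≡ c * ⟪ f , π ⟫
  ⟪⟫-⊙ c f π = trans (sum-cong-≗ (λ e → *-assoc c (f e) (diff π e)))
    (sym (*-distribˡ-sum c (λ e → f e * diff π e)))

  zero-flow : Flow (λ _ → 0ℤ)
  zero-flow = flow λ π → sum-zero _ (λ e → *-zeroˡ (diff π e))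

  flow-⊕ : ∀ {f g} → Flow f → Flow g → Flow (f ⊕ g)
  flow-⊕ {f} {g} F H = flow λ π → trans (⟪⟫-⊕ f g π) (cong₂ _+_ (conserved F π) (conserved H π))

  flow-⊙ : ∀ c {f} → Flow f → Flow (c ⊙ f)
  flow-⊙ c {f} F = flow λ π → trans (⟪⟫-⊙ c f π) (trans (cong (c *_) (conserved F π)) (*-zeroʳ c))

  closed-flow : ∀ {w x} → Bdry w x x → Flow w
  closed-flow {x = x} b = flow λ π → trans (telescope b π) (+-inverseʳ (π x))

  bdry-nil : ∀ x → Bdry (λ _ → 0ℤ) x x
  bdry-nil x = bdry λ π → trans (conserved zero-flow π) (sym (+-inverseʳ (π x)))

  bdry-trans : ∀ {f g x y z} → Bdry f x y → Bdry g y z → Bdry (f ⊕ g) x z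
  bdry-trans {f} {g} {x} {y} {z} F H = bdry λ π →
    trans (⟪⟫-⊕ f g π) (trans (cong₂ _+_ (telescope F π) (telescope H π)) (tele (π x) (π y) (π z)))
    where
    tele : ∀ a b c → (b - a) + (c - b) ≡ c - a
    tele = solve-∀

  bdry-sym : ∀ {f x y} → Bdry f x y → Bdry (-1ℤ ⊙ f) y x
  bdry-sym {f} {x} {y} F = bdry λ π →
    trans (⟪⟫-⊙ -1ℤ f π) (trans (cong (-1ℤ *_) (telescope F π)) (flip (π x) (π y)))
    where
    flip : ∀ a b → -1ℤ * (b - a) ≡ a - b
    flip = solve-∀

  bdry-δ : ∀ e → Bdry (δ e) (src e) (tgt e)
  bdry-δ e = bdry λ π → sum-δ e (diff π)

  Joins : E → V → V → Set
  Joins e u v = (src e ≡ u × tgt e ≡ v) ⊎ (src e ≡ v × tgt e ≡ u)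

  edge-walk : ∀ {e u v} → Joins e u v → ∃ λ s → Bdry s u v × Unit (s e) × (∀ f → e ≢ f → s f ≡ 0ℤ)
  edge-walk {e} (inj₁ (refl , refl)) = δ e , bdry-δ e , inj₁ (δ-refl e) , λ f → δ-≢
  edge-walk {e} (inj₂ (refl , refl)) = -1ℤ ⊙ δ e , bdry-sym (bdry-δ e) ,
    inj₂ (cong (-1ℤ *_) (δ-refl e)) , λ f e≢f → cong (-1ℤ *_) (δ-≢ e≢f)

  data Arc (Fw Bw : E → Set) : V → V → Set where
    fw : ∀ e → Fw e → Arc Fw Bw (src e) (tgt e)
    bw : ∀ e → Bw e → Arc Fw Bw (tgt e) (src e)

  Directed : (Fw Bw : E → Set) → Chain → Set
  Directed Fw Bw w = ∀ e → w e ≡ 0ℤ ⊎ (w e ≡ 1ℤ × Fw e) ⊎ (w e ≡ -1ℤ × Bw e)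

  Supported : Subset (n G) → Chain → Set
  Supported S w = ∀ e → w e ≡ 0ℤ ⊎ (src e ∈ S × tgt e ∈ S)

  -- Either a target lies in `S` and is reached, or `S` is a cut with no admissible arc leaving it.
  -- Reaching is recorded twice: `path` yields directed paths in orientations, `walk` yields chains
  -- that can be added to flows.
  record Reach (Fw Bw : E → Set) (x : V) : Set where
    field
      S         : Subset (n G)
      root      : x ∈ S
      closed-fw : ∀ e → Fw e → src e ∈ S → tgt e ∈ S
      closed-bw : ∀ e → Bw e → tgt e ∈ S → src e ∈ S
      path      : ∀ {v} → v ∈ S → Star (Arc Fw Bw) x v
      walk      : ∀ {v} → v ∈ S → ∃ λ w → Bdry w x v × Directed Fw Bw w × Supported S w

  module _ {Fw Bw : E → Set} (Fw? : ∀ e → Dec (Fw e)) (Bw? : ∀ e → Dec (Bw e)) (x : V) where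

    private
      -- The support condition makes the arc to a new vertex fresh, so the walks never repeat an
      -- edge and their chains keep values in {-1, 0, 1}.
      Tree : Subset (n G) → V → Set
      Tree S v = Star (Arc Fw Bw) x v × ∃ λ w → Bdry w x v × Directed Fw Bw w × Supported S w

      weaken : ∀ {S T v} → (∀ {u} → u ∈ S → u ∈ T) → Tree S v → Tree T v
      weaken S⊆T (p , w , b , d , s) = p , w , b , d , λ e → [ inj₁ , (λ (a , c) → inj₂ (S⊆T a , S⊆T c)) ]′ (s e)

      fresh-fw : ∀ {S} e → Fw e → src e ∈ S → tgt e ∉ S → Tree S (src e) → Tree (S ∪ ⁅ tgt e ⁆) (tgt e)
      fresh-fw {S} e Fe s∈ t∉ (p , w , b , d , s) =
        p ◅◅ (fw e Fe ◅ ε) , w ⊕ δ e , bdry-trans b (bdry-δ e) , dir , supp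
        where
        we≡0 : w e ≡ 0ℤ
        we≡0 = [ (λ z → z) , (λ (_ , t∈) → contradiction t∈ t∉) ]′ (s e)
        same : ∀ f → e ≢ f → w f + δ e f ≡ w f
        same f e≢f = trans (cong (λ z → w f + z) (δ-≢ e≢f)) (+-identityʳ (w f))
        dir : Directed Fw Bw (w ⊕ δ e)
        dir f with e ≟ᶠ f
        ... | yes refl = inj₂ (inj₁ (cong₂ _+_ we≡0 (δ-refl e) , Fe))
        ... | no e≢f   = subst (λ z → z ≡ 0ℤ ⊎ (z ≡ 1ℤ × Fw f) ⊎ (z ≡ -1ℤ × Bw f)) (sym (same f e≢f)) (d f)
        supp : Supported (S ∪ ⁅ tgt e ⁆) (w ⊕ δ e)
        supp f with e ≟ᶠ f
        ... | yes refl = inj₂ (p⊆p∪q _ s∈ , q⊆p∪q S _ (x∈⁅x⁆ (tgt e)))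
        ... | no e≢f   = [ (λ z → inj₁ (trans (same f e≢f) z)) , (λ (a , c) → inj₂ (p⊆p∪q _ a , p⊆p∪q _ c)) ]′ (s f)

      fresh-bw : ∀ {S} e → Bw e → tgt e ∈ S → src e ∉ S → Tree S (tgt e) → Tree (S ∪ ⁅ src e ⁆) (src e)
      fresh-bw {S} e Be t∈ s∉ (p , w , b , d , s) =
        p ◅◅ (bw e Be ◅ ε) , w ⊕ -1ℤ ⊙ δ e , bdry-trans b (bdry-sym (bdry-δ e)) , dir , supp
        where
        we≡0 : w e ≡ 0ℤ
        we≡0 = [ (λ z → z) , (λ (s∈ , _) → contradiction s∈ s∉) ]′ (s e)
        same : ∀ f → e ≢ f → w f + -1ℤ * δ e f ≡ w f
        same f e≢f = trans (cong (λ z → w f + -1ℤ * z) (δ-≢ e≢f)) (+-identityʳ (w f))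
        dir : Directed Fw Bw (w ⊕ -1ℤ ⊙ δ e)
        dir f with e ≟ᶠ f
        ... | yes refl = inj₂ (inj₂ (cong₂ (λ y z → y + -1ℤ * z) we≡0 (δ-refl e) , Be))
        ... | no e≢f   = subst (λ z → z ≡ 0ℤ ⊎ (z ≡ 1ℤ × Fw f) ⊎ (z ≡ -1ℤ × Bw f)) (sym (same f e≢f)) (d f)
        supp : Supported (S ∪ ⁅ src e ⁆) (w ⊕ -1ℤ ⊙ δ e)
        supp f with e ≟ᶠ f
        ... | yes refl = inj₂ (q⊆p∪q S _ (x∈⁅x⁆ (src e)) , p⊆p∪q _ t∈)
        ... | no e≢f   = [ (λ z → inj₁ (trans (same f e≢f) z)) , (λ (a , c) → inj₂ (p⊆p∪q _ a , p⊆p∪q _ c)) ]′ (s f)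

      insert : ∀ {S v} → (∀ {u} → u ∈ S → Tree S u) → Tree (S ∪ ⁅ v ⁆) v →
               ∀ {u} → u ∈ S ∪ ⁅ v ⁆ → Tree (S ∪ ⁅ v ⁆) u
      insert {S} {v} T new u∈ with x∈p∪q⁻ S ⁅ v ⁆ u∈
      ... | inj₁ u∈S = weaken (p⊆p∪q _) (T u∈S)
      ... | inj₂ u∈v rewrite x∈⁅y⁆⇒x≡y v u∈v = new

      grown : ∀ {S : Subset (n G)} {v} → v ∉ S → (S ∪ ⁅ v ⁆) ⊃ S
      grown {S} {v} v∉S = p⊆p∪q _ , v , q⊆p∪q S _ (x∈⁅x⁆ v) , v∉S

      grow : ∀ S → Acc _⊃_ S → x ∈ S → (∀ {v} → v ∈ S → Tree S v) → Reach Fw Bw x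
      grow S (acc rec) x∈S T
        with any? (λ e → Fw? e ×-dec src e ∈? S ×-dec ¬? (tgt e ∈? S))
           | any? (λ e → Bw? e ×-dec tgt e ∈? S ×-dec ¬? (src e ∈? S))
      ... | yes (e , Fe , s∈ , t∉) | _ =
        grow _ (rec (grown t∉)) (p⊆p∪q _ x∈S) (insert T (fresh-fw e Fe s∈ t∉ (T s∈)))
      ... | no _ | yes (e , Be , t∈ , s∉) =
        grow _ (rec (grown s∉)) (p⊆p∪q _ x∈S) (insert T (fresh-bw e Be t∈ s∉ (T t∈)))
      ... | no ¬fw | no ¬bw = record
        { S = S ; root = x∈S
        ; closed-fw = λ e Fe s∈ → decidable-stable (tgt e ∈? S) (λ t∉ → ¬fw (e , Fe , s∈ , t∉))
        ; closed-bw = λ e Be t∈ → decidable-stable (src e ∈? S) (λ s∉ → ¬bw (e , Be , t∈ , s∉))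
        ; path = λ v∈ → proj₁ (T v∈)
        ; walk = λ v∈ → proj₂ (T v∈)
        }

    reach : Reach Fw Bw x
    reach = grow ⁅ x ⁆ (⊃-wellFounded _) (x∈⁅x⁆ x) start
      where
      start : ∀ {v} → v ∈ ⁅ x ⁆ → Tree ⁅ x ⁆ v
      start v∈ rewrite x∈⁅y⁆⇒x≡y x v∈ = ε , (λ _ → 0ℤ) , bdry-nil x , (λ _ → inj₁ refl) , (λ _ → inj₁ refl)

-- Lower bounds on sums, and the excess of an integer over a bound.

1≰0 : ¬ (1ℤ ≤ 0ℤ)
1≰0 (+≤+ ())

1≤-of : ∀ {z} → 0ℤ ≤ z → z ≢ 0ℤ → 1ℤ ≤ z
1≤-of 0≤z z≢0 = i<j⇒suc[i]≤j (≤∧≢⇒< 0≤z (z≢0 ∘ sym))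

sum-pos₁ : ∀ {k} {h : Fin k → ℤ} {f} → (∀ i → 0ℤ ≤ h i) → 1ℤ ≤ h f → 1ℤ ≤ sum h
sum-pos₁ {h = h} {f} h≥0 hf = subst (_≤ sum h) (sum-δ-1 f) (sum-mono (δ f) h bound)
  where
  bound : ∀ i → δ f i ≤ h i
  bound i with f ≟ᶠ i
  ... | yes refl = subst (_≤ h f) (sym (δ-refl f)) hf
  ... | no f≢i   = subst (_≤ h i) (sym (δ-≢ f≢i)) (h≥0 i)

-- Taking 1 away at `f` keeps all terms nonnegative and leaves the term at `f′` alone, so `sum-pos₁`
-- applies to the rest.
sum-pos₂ : ∀ {k} {h : Fin k → ℤ} {f f′} → f ≢ f′ → (∀ i → 0ℤ ≤ h i) →
           1ℤ ≤ h f → 1ℤ ≤ h f′ → + 2 ≤ sum h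
sum-pos₂ {h = h} {f} {f′} f≢f′ h≥0 hf hf′ = begin
  + 2                              ≤⟨ +-monoʳ-≤ 1ℤ (sum-pos₁ {h = rest} rest≥0 rest-f′) ⟩
  1ℤ + sum rest                    ≡⟨ cong (_+ sum rest) (sym (sum-δ-1 f)) ⟩
  sum (δ f) + sum rest             ≡⟨ sym (∑-distrib-+ (δ f) rest) ⟩
  sum (λ i → δ f i + rest i)       ≡⟨ sum-cong-≗ (λ i → cancel (δ f i) (h i)) ⟩
  sum h                            ∎
  where
  open ≤-Reasoning
  rest : Fin _ → ℤ
  rest i = h i - δ f i
  cancel : ∀ a b → a + (b - a) ≡ b
  cancel = solve-∀
  rest≥0 : ∀ i → 0ℤ ≤ rest i
  rest≥0 i with f ≟ᶠ i
  ... | yes refl = subst (λ z → 0ℤ ≤ h f - z) (sym (δ-refl f)) (i≤j⇒0≤j-i hf)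
  ... | no f≢i   = subst (λ z → 0ℤ ≤ h i - z) (sym (δ-≢ f≢i)) (subst (0ℤ ≤_) (sym (+-identityʳ (h i))) (h≥0 i))
  rest-f′ : 1ℤ ≤ rest f′
  rest-f′ = subst (λ z → 1ℤ ≤ h f′ - z) (sym (δ-≢ f≢f′)) (subst (1ℤ ≤_) (sym (+-identityʳ (h f′))) hf′)

-- Adding 1 at `d` makes up for the only possibly negative term; the total is then at least 2. Here
-- `d` will be the arc to be deleted and `f`, `f′` two other edges of a cut.
sum-pos₂₁ : ∀ {k} {h : Fin k → ℤ} {d f f′} → d ≢ f → d ≢ f′ → f ≢ f′ →
            (∀ i → d ≢ i → 0ℤ ≤ h i) → -1ℤ ≤ h d → 1ℤ ≤ h f → 1ℤ ≤ h f′ → 1ℤ ≤ sum h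
sum-pos₂₁ {h = h} {d} {f} {f′} d≢f d≢f′ f≢f′ h≥0 hd hf hf′ = begin
  1ℤ                    ≤⟨ +-monoˡ-≤ -1ℤ (sum-pos₂ {h = h⁺} f≢f′ h⁺≥0 (h⁺-≢ d≢f hf) (h⁺-≢ d≢f′ hf′)) ⟩
  sum h⁺ + -1ℤ          ≡⟨ cong (_+ -1ℤ) (trans (∑-distrib-+ h (δ d)) (cong (λ z → sum h + z) (sum-δ-1 d))) ⟩
  (sum h + 1ℤ) + -1ℤ    ≡⟨ cancel (sum h) ⟩
  sum h                 ∎
  where
  open ≤-Reasoning
  h⁺ : Fin _ → ℤ
  h⁺ i = h i + δ d i
  cancel : ∀ a → (a + 1ℤ) + -1ℤ ≡ a
  cancel = solve-∀
  h⁺-≢ : ∀ {a i} → d ≢ i → a ≤ h i → a ≤ h⁺ i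
  h⁺-≢ {a} {i} d≢i a≤ = subst (λ z → a ≤ h i + z) (sym (δ-≢ d≢i)) (subst (a ≤_) (sym (+-identityʳ (h i))) a≤)
  h⁺≥0 : ∀ i → 0ℤ ≤ h⁺ i
  h⁺≥0 i with d ≟ᶠ i
  ... | yes refl = subst (λ z → 0ℤ ≤ h d + z) (sym (δ-refl d)) (+-monoˡ-≤ 1ℤ hd)
  ... | no d≢i   = h⁺-≢ d≢i (h≥0 i d≢i)

ℕsum-mono : ∀ {k} (f g : Fin k → ℕ) → (∀ i → f i ℕ.≤ g i) → ℕΣ.sum f ℕ.≤ ℕΣ.sum g
ℕsum-mono {ℕ.zero}  f g f≤g = z≤n
ℕsum-mono {ℕ.suc k} f g f≤g = ℕ.+-mono-≤ (f≤g zero) (ℕsum-mono (f ∘ suc) (g ∘ suc) (f≤g ∘ suc))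

ℕsum-strict : ∀ {k} (f g : Fin k → ℕ) → (∀ i → f i ℕ.≤ g i) → ∀ i → f i ℕ.< g i → ℕΣ.sum f ℕ.< ℕΣ.sum g
ℕsum-strict f g f≤g zero    fi<gi = ℕ.+-mono-<-≤ fi<gi (ℕsum-mono (f ∘ suc) (g ∘ suc) (f≤g ∘ suc))
ℕsum-strict f g f≤g (suc i) fi<gi = ℕ.+-mono-≤-< (f≤g zero) (ℕsum-strict (f ∘ suc) (g ∘ suc) (f≤g ∘ suc) i fi<gi)

≤ℕsum : ∀ {k} (f : Fin k → ℕ) i → f i ℕ.≤ ℕΣ.sum f
≤ℕsum f zero    = ℕ.m≤m+n _ _
≤ℕsum f (suc i) = ℕ.≤-trans (≤ℕsum (f ∘ suc) i) (ℕ.m≤n+m _ _)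

-- If `k ≤ a`, subtracting `k + 1` from `a + 1` leaves the nonnegative number `a - k`. Otherwise the
-- result is negative, but its absolute value `k - a` is at most `k`, so its excess is 0.
⊖-excess : ∀ a k → (∣ ℕ.suc a ⊖ ℕ.suc k ∣ ℕ.∸ k ℕ.≤ ℕ.suc a ℕ.∸ k) ×
           (k ℕ.< ℕ.suc a → ∣ ℕ.suc a ⊖ ℕ.suc k ∣ ℕ.∸ k ℕ.< ℕ.suc a ℕ.∸ k)
⊖-excess a k rewrite [1+m]⊖[1+n]≡m⊖n a k with ℕ.≤-total k a
... | inj₁ k≤a rewrite ⊖-≥ k≤a | ℕ.+-∸-assoc 1 k≤a =
  ℕ.m≤n⇒m≤1+n (ℕ.m∸n≤m (a ℕ.∸ k) k) , λ _ → s≤s (ℕ.m∸n≤m (a ℕ.∸ k) k)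
... | inj₂ a≤k rewrite ⊖-≤ a≤k | ∣-i∣≡∣i∣ (+ (k ℕ.∸ a)) | ℕ.m≤n⇒m∸n≡0 (ℕ.m∸n≤m k a) =
  z≤n , ℕ.m<n⇒0<n∸m

Lowers : ℕ → ℤ → ℤ → ℤ → Set
Lowers k z c z′ =
  (∣ z′ ∣ ℕ.∸ k ℕ.≤ ∣ z ∣ ℕ.∸ k) × (c ≢ 0ℤ → k ℕ.< ∣ z ∣ → ∣ z′ ∣ ℕ.∸ k ℕ.< ∣ z ∣ ℕ.∸ k)

-- Here `z` is a flow value and `c` the coefficient of a cycle that follows the signs of the flow.
-- The shift by `k + 1` is towards zero, and where it overshoots, the absolute value stays at most
-- `k`.
shift-excess : ∀ k z c → c ≡ 0ℤ ⊎ (c ≡ 1ℤ × 0ℤ < z) ⊎ (c ≡ -1ℤ × z < 0ℤ) →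
               Lowers k z c (z + - (+ ℕ.suc k) * c)
shift-excess k z c (inj₁ refl) = subst (Lowers k z c) (sym (stays z (+ ℕ.suc k)))
  (ℕ.≤-refl , λ c≢0 → contradiction refl c≢0)
  where
  stays : ∀ a K → a + - K * 0ℤ ≡ a
  stays = solve-∀
shift-excess k (+ ℕ.suc a) c (inj₂ (inj₁ (refl , _))) = subst (Lowers k (+ ℕ.suc a) c)
  (sym (down (+ ℕ.suc a) (+ ℕ.suc k))) (proj₁ (⊖-excess a k) , λ _ → proj₂ (⊖-excess a k))
  where
  down : ∀ a K → a + - K * 1ℤ ≡ a - K
  down = solve-∀
shift-excess k (+ ℕ.zero) c (inj₂ (inj₁ (refl , +<+ ())))
shift-excess k -[1+ a ] c (inj₂ (inj₂ (refl , _))) = subst (Lowers k -[1+ a ] c)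
  (sym (up -[1+ a ] (+ ℕ.suc k)))
  (subst (λ x → (x ℕ.∸ k ℕ.≤ ℕ.suc a ℕ.∸ k) × (c ≢ 0ℤ → k ℕ.< ℕ.suc a → x ℕ.∸ k ℕ.< ℕ.suc a ℕ.∸ k))
    (∣m⊖n∣≡∣n⊖m∣ (ℕ.suc a) (ℕ.suc k))
    (proj₁ (⊖-excess a k) , λ _ → proj₂ (⊖-excess a k)))
  where
  up : ∀ a K → a + - K * -1ℤ ≡ a + K
  up = solve-∀
shift-excess k (+ a) c (inj₂ (inj₂ (refl , +<+ ())))

-- Cuts and the modular reduction of flows.

module Cuts (G : Graph) where

  open Chains G

  Crosses : Subset (n G) → E → Set
  Crosses S e = (src e ∈ S × tgt e ∉ S) ⊎ (src e ∉ S × tgt e ∈ S)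

  cutView : ∀ S e →
    ((src e ∈ S → tgt e ∈ S) × (tgt e ∈ S → src e ∈ S) × diff (ind S) e ≡ 0ℤ) ⊎
    ((src e ∈ S × tgt e ∉ S) × diff (ind S) e ≡ -1ℤ) ⊎
    ((src e ∉ S × tgt e ∈ S) × diff (ind S) e ≡ 1ℤ)
  cutView S e with src e ∈? S | tgt e ∈? S
  ... | yes s | yes t = inj₁ ((λ _ → t) , (λ _ → s) , refl)
  ... | yes s | no t  = inj₂ (inj₁ ((s , t) , refl))
  ... | no s  | yes t = inj₂ (inj₂ ((s , t) , refl))
  ... | no s  | no t  = inj₁ ((λ x → contradiction x s) , (λ x → contradiction x t) , refl)

  -- Oriented by the sign of `g`, the edge does not leave `S`; so it can only contribute to the flow
  -- into `S`.
  closed-nonneg : ∀ (g : Chain) S e → (0ℤ < g e → src e ∈ S → tgt e ∈ S) → (g e < 0ℤ → tgt e ∈ S → src e ∈ S) →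
                  0ℤ ≤ g e * diff (ind S) e
  closed-nonneg g S e f b with cutView S e
  ... | inj₁ (_ , _ , d) = ≤-reflexive (sym (trans (cong (g e *_) d) (*-zeroʳ (g e))))
  ... | inj₂ (inj₁ ((s , t) , d)) = subst (0ℤ ≤_)
    (sym (trans (cong (g e *_) d) (trans (*-comm (g e) -1ℤ) (-1*i≡-i (g e)))))
    (neg-mono-≤ (≮⇒≥ (λ p → t (f p s))))
  ... | inj₂ (inj₂ ((s , t) , d)) = subst (0ℤ ≤_)
    (sym (trans (cong (g e *_) d) (*-identityʳ (g e))))
    (≮⇒≥ (λ p → s (b p t)))

  crosses-nonzero : ∀ (g : Chain) S e → Crosses S e → g e ≢ 0ℤ → g e * diff (ind S) e ≢ 0ℤ
  crosses-nonzero g S e X g≢0 gd≡0 with i*j≡0⇒i≡0∨j≡0 (g e) gd≡0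
  ... | inj₁ g≡0 = g≢0 g≡0
  ... | inj₂ d≡0 with X
  ...   | inj₁ (s , t) = contradiction (trans (sym (cong₂ _-_ (ind-∉ t) (ind-∈ s))) d≡0) (λ ())
  ...   | inj₂ (s , t) = contradiction (trans (sym (cong₂ _-_ (ind-∈ t) (ind-∉ s))) d≡0) (λ ())

  closed-pos : ∀ (g : Chain) S e → (0ℤ < g e → src e ∈ S → tgt e ∈ S) → (g e < 0ℤ → tgt e ∈ S → src e ∈ S) →
               Crosses S e → g e ≢ 0ℤ → 1ℤ ≤ g e * diff (ind S) e
  closed-pos g S e f b X g≢0 = 1≤-of (closed-nonneg g S e f b) (crosses-nonzero g S e X g≢0)

  -- Meant for the deleted arc, which may leave a set that is closed under all other arcs; the loss
  -- is then at most its value 1.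
  unit-cut : ∀ (g : Chain) S e → Unit (g e) → -1ℤ ≤ g e * diff (ind S) e
  unit-cut g S e u with cutView S e
  unit-cut g S e (inj₁ u) | inj₁ (_ , _ , d)        rewrite u | d = -≤+
  unit-cut g S e (inj₂ u) | inj₁ (_ , _ , d)        rewrite u | d = -≤+
  unit-cut g S e (inj₁ u) | inj₂ (inj₁ (_ , d))     rewrite u | d = ≤-refl
  unit-cut g S e (inj₂ u) | inj₂ (inj₁ (_ , d))     rewrite u | d = -≤+
  unit-cut g S e (inj₁ u) | inj₂ (inj₂ (_ , d))     rewrite u | d = -≤+
  unit-cut g S e (inj₂ u) | inj₂ (inj₂ (_ , d))     rewrite u | d = ≤-refl

  crossing : ∀ {present S x y} → UReach G present x y → x ∈ S → y ∉ S → ∃ λ e → present e × Crosses S e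
  crossing here x∈ y∉ = contradiction x∈ y∉
  crossing {S = S} (fwd e p refl r) x∈ y∉ with tgt e ∈? S
  ... | yes t = crossing r t y∉
  ... | no t  = e , p , inj₁ (x∈ , t)
  crossing {S = S} (bwd e p refl r) x∈ y∉ with src e ∈? S
  ... | yes s = crossing r s y∉
  ... | no s  = e , p , inj₂ (s , x∈)

  Conforms : Chain → Chain → Set
  Conforms g = Directed (λ e → 0ℤ < g e) (λ e → g e < 0ℤ)

  -- Search from the head of `e` along the flow. If the tail is not reached, `e` enters the reached
  -- set and nothing leaves it, against conservation. The search avoids `e`, so that closing the
  -- walk with `e` gives it coefficient exactly 1.
  cycle-through-positive : ∀ {g e} → Flow g → 0ℤ < g e → ∃ λ c → Flow c × Conforms g c × c e ≢ 0ℤ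
  cycle-through-positive {g} {e} F 0<ge = case-of-reach
    (reach (λ f → ¬? (f ≟ᶠ e) ×-dec 0ℤ <? g f) (λ f → ¬? (f ≟ᶠ e) ×-dec g f <? 0ℤ) (tgt e))
    where
    case-of-reach : Reach (λ f → f ≢ e × 0ℤ < g f) (λ f → f ≢ e × g f < 0ℤ) (tgt e) →
                    ∃ λ c → Flow c × Conforms g c × c e ≢ 0ℤ
    case-of-reach R with src e ∈? Reach.S R
    ... | yes s∈ = w ⊕ δ e , closed-flow (bdry-trans b (bdry-δ e)) , conf ,
                   λ z → contradiction (trans (sym ce≡1) z) (λ ())
      where
      w = proj₁ (Reach.walk R s∈)
      b = proj₁ (proj₂ (Reach.walk R s∈))
      d = proj₁ (proj₂ (proj₂ (Reach.walk R s∈)))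
      ce≡1 : w e + δ e e ≡ 1ℤ
      ce≡1 with d e
      ... | inj₁ z                    = cong₂ _+_ z (δ-refl e)
      ... | inj₂ (inj₁ (_ , e≢e , _)) = contradiction refl e≢e
      ... | inj₂ (inj₂ (_ , e≢e , _)) = contradiction refl e≢e
      conf : Conforms g (w ⊕ δ e)
      conf f with e ≟ᶠ f
      ... | yes refl = inj₂ (inj₁ (ce≡1 , 0<ge))
      ... | no e≢f rewrite δ-≢ e≢f | +-identityʳ (w f) with d f
      ...   | inj₁ z                  = inj₁ z
      ...   | inj₂ (inj₁ (z , _ , p)) = inj₂ (inj₁ (z , p))
      ...   | inj₂ (inj₂ (z , _ , p)) = inj₂ (inj₂ (z , p))
    ... | no s∉ = contradiction (subst (1ℤ ≤_) (conserved F (ind S)) (sum-pos₁ {f = e} nonneg entering)) 1≰0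
      where
      open Reach R
      nonneg : ∀ f → 0ℤ ≤ g f * diff (ind S) f
      nonneg f with f ≟ᶠ e
      ... | yes refl = closed-nonneg g S e (λ _ s∈ → contradiction s∈ s∉) (λ ge<0 → contradiction ge<0 (<-asym 0<ge))
      ... | no f≢e   = closed-nonneg g S f (λ p → closed-fw f (f≢e , p)) (λ p → closed-bw f (f≢e , p))
      entering : 1ℤ ≤ g e * diff (ind S) e
      entering = 1≤-of (nonneg e) (crosses-nonzero g S e (inj₂ (s∉ , root)) (λ z → <⇒≢ 0<ge (sym z)))

  cycle-through : ∀ {g e} → Flow g → g e ≢ 0ℤ → ∃ λ c → Flow c × Conforms g c × c e ≢ 0ℤ
  cycle-through {g} {e} F ge≢0 with <-cmp 0ℤ (g e)
  ... | tri< 0<ge _ _ = cycle-through-positive F 0<ge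
  ... | tri≈ _ 0≡ge _ = contradiction (sym 0≡ge) ge≢0
  ... | tri> _ _ ge<0 =
    let c , Fc , conf , ce≢0 = cycle-through-positive {g = -1ℤ ⊙ g} {e} (flow-⊙ -1ℤ F) (subst (0ℤ <_) (sym (-1*i≡-i (g e))) (neg-mono-< ge<0))
    in -1ℤ ⊙ c , flow-⊙ -1ℤ Fc , neg-conf c conf , λ z → ce≢0 (neg-injective (trans (sym (-1*i≡-i (c e))) z))
    where
    neg-conf : ∀ c → Conforms (-1ℤ ⊙ g) c → Conforms g (-1ℤ ⊙ c)
    neg-conf c conf f rewrite -1*i≡-i (c f) with conf f
    ... | inj₁ z              = inj₁ (cong -_ z)
    ... | inj₂ (inj₁ (z , p)) = inj₂ (inj₂ (cong -_ z , neg-cancel-< (subst (0ℤ <_) (-1*i≡-i (g f)) p)))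
    ... | inj₂ (inj₂ (z , p)) = inj₂ (inj₁ (cong -_ z , neg-cancel-< (subst (_< 0ℤ) (-1*i≡-i (g f)) p)))

  -- Tutte's reduction of a flow modulo k + 1: subtracting k + 1 times a directed cycle through an
  -- edge of value beyond k lowers the total excess over k.
  reduce : ∀ k {h} → Flow h → ∃ λ g → Flow g × (∀ e → + ℕ.suc k ∣ g e - h e) × (∀ e → ∣ g e ∣ ℕ.≤ k)
  reduce k {h} = go h (<-wellFounded _)
    where
    excess : Chain → E → ℕ
    excess h e = ∣ h e ∣ ℕ.∸ k
    go : ∀ h → Acc ℕ._<_ (ℕΣ.sum (excess h)) → Flow h →
         ∃ λ g → Flow g × (∀ e → + ℕ.suc k ∣ g e - h e) × (∀ e → ∣ g e ∣ ℕ.≤ k)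
    go h (acc rec) F with any? (λ e → k ℕ.<? ∣ h e ∣)
    ... | no none = h , F , (λ e → divides 0ℤ (trans (+-inverseʳ (h e)) (sym (*-zeroˡ (+ ℕ.suc k))))) , λ e → ℕ.≮⇒≥ (λ p → none (e , p))
    ... | yes (e , k<he) with cycle-through {h} {e} F (λ z → ℕ.n≮0 (subst (k ℕ.<_) (cong ∣_∣ z) k<he))
    ...   | c , Fc , conf , ce≢0
      with go h′ (rec (ℕsum-strict (excess h′) (excess h) (λ f → proj₁ (shift-excess k (h f) (c f) (conf f))) e
                 (proj₂ (shift-excess k (h e) (c e) (conf e)) ce≢0 k<he)))
              (flow-⊕ {h} F (flow-⊙ (- (+ ℕ.suc k)) {c} Fc))
      where
      h′ = h ⊕ - (+ ℕ.suc k) ⊙ c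
    ...   | g , Fg , dv , bd = g , Fg , (λ f → shift (g f) (h f) (c f) (+ ℕ.suc k) (dv f)) , bd
      where
      arith : ∀ a b c q K → a - (b + - K * c) ≡ q * K → (a - (b + - K * c)) - K * c ≡ q * K - K * c
      arith a b c q K eq = cong (_- K * c) eq
      lhs : ∀ a b c K → (a - (b + - K * c)) - K * c ≡ a - b
      lhs = solve-∀
      rhs : ∀ q c K → q * K - K * c ≡ (q - c) * K
      rhs = solve-∀
      shift : ∀ a b c K → K ∣ a - (b + - K * c) → K ∣ a - b
      shift a b c K (divides q eq) = divides (q - c)
        (trans (sym (lhs a b c K)) (trans (arith a b c q K eq) (rhs q c K)))

  -- Orientations along the signs of a flow.

  orient : Chain → Orientation G
  orient g e = ⌊ 0ℤ <? g e ⌋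

  tail-head-true : ∀ O e → O e ≡ true → tail G O e ≡ src e × head G O e ≡ tgt e
  tail-head-true O e eq with O e
  tail-head-true O e refl | true = refl , refl

  tail-head-false : ∀ O e → O e ≡ false → tail G O e ≡ tgt e × head G O e ≡ src e
  tail-head-false O e eq with O e
  tail-head-false O e refl | false = refl , refl

  orient-pos : ∀ g e → 0ℤ < g e → orient g e ≡ true
  orient-pos g e p with 0ℤ <? g e
  ... | yes _ = refl
  ... | no ¬p = contradiction p ¬p

  orient-neg : ∀ g e → g e < 0ℤ → orient g e ≡ false
  orient-neg g e p with 0ℤ <? g e
  ... | yes q = contradiction q (<-asym p)
  ... | no _  = refl

  module _ (g : Chain) {present : E → Set} (present? : ∀ e → Dec (present e)) where

    private
      Fw Bw : E → Set
      Fw e = present e × 0ℤ < g e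
      Bw e = present e × g e < 0ℤ

      directed : ∀ {x y} → Star (Arc Fw Bw) x y → DReach G (orient g) present x y
      directed ε = here
      directed (fw e (p , 0<ge) ◅ r) =
        let t , h = tail-head-true (orient g) e (orient-pos g e 0<ge)
        in step e p t (subst (λ z → DReach G (orient g) present z _) (sym h) (directed r))
      directed (bw e (p , ge<0) ◅ r) =
        let t , h = tail-head-false (orient g) e (orient-neg g e ge<0)
        in step e p t (subst (λ z → DReach G (orient g) present z _) (sym h) (directed r))

    -- If `y` were missed, the set reached from `x` would be a proper set that no present arc of
    -- nonzero value leaves. Hence it is enough to exclude such sets.
    directed-reach : (∀ S {x y} → x ∈ S → y ∉ S → ¬ (∀ e → present e →
                       (0ℤ < g e → src e ∈ S → tgt e ∈ S) × (g e < 0ℤ → tgt e ∈ S → src e ∈ S))) →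
                     ∀ x y → DReach G (orient g) present x y
    directed-reach no-cut x y =
      case-of-reach (reach (λ e → present? e ×-dec 0ℤ <? g e) (λ e → present? e ×-dec g e <? 0ℤ) x)
      where
      case-of-reach : Reach Fw Bw x → DReach G (orient g) present x y
      case-of-reach R with y ∈? Reach.S R
      ... | yes y∈ = directed (Reach.path R y∈)
      ... | no y∉  = ⊥-elim (no-cut (Reach.S R) (Reach.root R) y∉
                       λ e p → (λ q → Reach.closed-fw R e (p , q)) , (λ q → Reach.closed-bw R e (p , q)))

  module _ (conn : EdgeConnected 3 G) {g : Chain} (F : Flow g) (g≢0 : ∀ e → g e ≢ 0ℤ) where

    -- Connectivity provides an edge across the cut. If no arc left `S`, this edge would make the
    -- net flow into `S` positive.
    strongly-connected : StronglyConnected G (orient g)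
    strongly-connected = directed-reach g (λ _ → yes refl) λ S x∈ y∉ closed →
      let e , _ , X = crossing (conn [] (s≤s z≤n) _ _) x∈ y∉
          cl = λ f → closed f refl
          1≤0 = subst (1ℤ ≤_) (conserved F (ind S)) (sum-pos₁
            (λ f → closed-nonneg g S f (proj₁ (cl f)) (proj₂ (cl f)))
            (closed-pos g S e (proj₁ (cl e)) (proj₂ (cl e)) X (g≢0 e)))
      in 1≰0 1≤0

    -- In a cut whose only arc in one direction has value 1, the opposite arcs carry value 1 in
    -- total, but there are at least two of them.
    deletable : ∀ d → Unit (g d) → Deletable G (orient g) d
    deletable d u = directed-reach g (λ f → ¬? (f ≟ᶠ d)) λ S x∈ y∉ closed →
      -- Each removed list has at most two edges, so a crossing edge remains: first one other than
      -- `d`, then one other than both `d` and `f`.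
      let f  , f∉  , X  = crossing (conn (d ∷ []) (s≤s (s≤s z≤n)) _ _) x∈ y∉
          f′ , f′∉ , X′ = crossing (conn (d ∷ f ∷ []) (s≤s (s≤s (s≤s z≤n))) _ _) x∈ y∉
          cl = λ i d≢i → closed i (d≢i ∘ sym)
          cross = λ i d≢i X → closed-pos g S i (proj₁ (cl i d≢i)) (proj₂ (cl i d≢i)) X (g≢0 i)
          d≢f  = λ eq → f∉ (here (sym eq))
          d≢f′ = λ eq → f′∉ (here (sym eq))
          f≢f′ = λ eq → f′∉ (there (here (sym eq)))
          1≤0 = subst (1ℤ ≤_) (conserved F (ind S)) (sum-pos₂₁ {d = d} {f} {f′} d≢f d≢f′ f≢f′
            (λ i d≢i → closed-nonneg g S i (proj₁ (cl i d≢i)) (proj₂ (cl i d≢i)))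
            (unit-cut g S d u) (cross f d≢f X) (cross f′ d≢f′ X′))
      in 1≰0 1≤0

-- Partial 2-closures and their extension by ears and chords.

data Label : Set where
  todo first second circ : Label

todo? : ∀ l → Dec (l ≡ todo)
todo? todo   = yes refl
todo? first  = no λ ()
todo? second = no λ ()
todo? circ   = no λ ()

-- The numbers `p` and `q` are the flow values on the two edges of a pair, `s` and `r` the
-- coefficients of its closing circuit there, and `t` is the multiple of the circuit to be added.
Choosable : (A B : ℤ → Set) → Set
Choosable A B = ∀ p q {s r} → Unit s → Unit r → ∃ λ t → A (p + t * s) × B (q + t * r)

Settled : (A B : ℤ → Set) → ℤ → ℤ → Label → Set
Settled A B z z′ todo   = z′ ≡ z
Settled A B z z′ first  = A z′
Settled A B z z′ second = B z′
Settled A B z z′ circ   = ⊤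

Carries : Label → ℤ → Set
Carries circ z = Unit z
Carries _    z = z ≡ 0ℤ

module Closure (G : Graph) where

  open Chains G
  open Cuts G

  -- The quantifier over `A` and `B` lets one closure serve several demands: units on one kind of
  -- edge and nonzero values on the other, or values not divisible by 3 on both.
  Solvable : (E → Label) → Set₁
  Solvable lab = ∀ {A B} → Choosable A B → ∀ {g} → Flow g →
    ∃ λ g′ → Flow g′ × ∀ e → Settled A B (g e) (g′ e) (lab e)

  -- A partial 2-closure in Seymour's sense: the circ edges carry the {-1, 0, 1}-flow φ, and the
  -- first and second edges come in pairs, each closed by a circuit through earlier edges. Flows
  -- are adjusted along those circuits in reverse order.
  record Core (U : Subset (n G)) (lab : E → Label) : Set₁ where
    field
      solvable : Solvable lab
      φ        : Chain
      φ-flow   : Flow φ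
      carries  : ∀ e → Carries (lab e) (φ e)
      inside   : ∀ e → lab e ≢ todo → src e ∈ U × tgt e ∈ U

  Connected : Subset (n G) → (E → Label) → V → Set
  Connected U lab r = ∀ {x} → x ∈ U → ∃ λ w → Bdry w r x × (∀ e → lab e ≡ todo → w e ≡ 0ℤ)

  module _ (e₁ e₂ : E) (lab : E → Label) where

    pairLab : E → Label
    pairLab f with e₁ ≟ᶠ f | e₂ ≟ᶠ f
    ... | yes _ | _     = first
    ... | no _  | yes _ = second
    ... | no _  | no _  = lab f

    pairLab-todo : ∀ f → pairLab f ≡ todo → e₁ ≢ f × e₂ ≢ f × lab f ≡ todo
    pairLab-todo f eq with e₁ ≟ᶠ f | e₂ ≟ᶠ f
    ... | no p | no q = p , q , eq

    pairLab-done : ∀ f → pairLab f ≢ todo → e₁ ≡ f ⊎ e₂ ≡ f ⊎ lab f ≢ todo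
    pairLab-done f neq with e₁ ≟ᶠ f | e₂ ≟ᶠ f
    ... | yes p | _     = inj₁ p
    ... | no _  | yes q = inj₂ (inj₁ q)
    ... | no _  | no _  = inj₂ (inj₂ neq)

    module _ {w : Chain} (W : Flow w) (todo₁ : lab e₁ ≡ todo) (todo₂ : lab e₂ ≡ todo)
             (unit₁ : Unit (w e₁)) (unit₂ : Unit (w e₂))
             (off : ∀ f → lab f ≡ todo → e₁ ≢ f → e₂ ≢ f → w f ≡ 0ℤ) where

      pair-solvable : Solvable lab → Solvable pairLab
      pair-solvable sol {A} {B} ch {g} F with ch (g e₁) (g e₂) unit₁ unit₂
      ... | t , a , b with sol ch (flow-⊕ F (flow-⊙ t W))
      ...   | g′ , F′ , settled = g′ , F′ , λ f → settle f (settled f)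
        where
        settle : ∀ f → Settled A B (g f + t * w f) (g′ f) (lab f) → Settled A B (g f) (g′ f) (pairLab f)
        settle f st with e₁ ≟ᶠ f | e₂ ≟ᶠ f
        ... | yes refl | _        rewrite todo₁ = subst A (sym st) a
        ... | no _     | yes refl rewrite todo₂ = subst B (sym st) b
        ... | no p     | no q with lab f in eq
        ...   | todo   = trans st (trans (cong (λ z → g f + t * z) (off f eq p q))
                           (trans (cong (λ z → g f + z) (*-zeroʳ t)) (+-identityʳ (g f))))
        ...   | first  = st
        ...   | second = st
        ...   | circ   = st

      pair-core : ∀ {U} → src e₁ ∈ U × tgt e₁ ∈ U → src e₂ ∈ U × tgt e₂ ∈ U → Core U lab → Core U pairLab
      pair-core {U} in₁ in₂ C = record
        { solvable = pair-solvable solvable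
        ; φ = φ
        ; φ-flow = φ-flow
        ; carries = carries′
        ; inside = λ e neq → inside′ e (pairLab-done e neq)
        }
        where
        open Core C
        carries′ : ∀ f → Carries (pairLab f) (φ f)
        carries′ f with e₁ ≟ᶠ f | e₂ ≟ᶠ f
        ... | yes refl | _        = subst (λ l → Carries l (φ e₁)) todo₁ (carries e₁)
        ... | no _     | yes refl = subst (λ l → Carries l (φ e₂)) todo₂ (carries e₂)
        ... | no _     | no _     = carries f
        inside′ : ∀ f → e₁ ≡ f ⊎ e₂ ≡ f ⊎ lab f ≢ todo → src f ∈ U × tgt f ∈ U
        inside′ f (inj₁ refl)        = in₁
        inside′ f (inj₂ (inj₁ refl)) = in₂
        inside′ f (inj₂ (inj₂ neq))  = inside f neq

  module _ (ψ : Chain) (lab : E → Label) where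

    circLab : E → Label
    circLab f with ψ f ≟ 0ℤ
    ... | yes _ = lab f
    ... | no _  = circ

    circLab-zero : ∀ f → ψ f ≡ 0ℤ → circLab f ≡ lab f
    circLab-zero f z with ψ f ≟ 0ℤ
    ... | yes _  = refl
    ... | no ¬z  = contradiction z ¬z

    circLab-todo : ∀ f → circLab f ≡ todo → ψ f ≡ 0ℤ × lab f ≡ todo
    circLab-todo f eq with ψ f ≟ 0ℤ
    ... | yes z = z , eq

    -- The support of `ψ` has its sources outside `U` while every labelled edge lies inside `U`. The
    -- supports of `φ` and `ψ` are therefore disjoint, and the sum still has values 1 or -1 on
    -- `circ` edges.
    circ-core : ∀ {U U′} → Flow ψ → (∀ e → Small (ψ e)) → (∀ {v} → v ∈ U → v ∈ U′) →
                (∀ e → ψ e ≢ 0ℤ → src e ∉ U × src e ∈ U′ × tgt e ∈ U′) → Core U lab → Core U′ circLab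
    circ-core {U} {U′} F small U⊆U′ new C = record
      { solvable = λ {A} {B} ch F → let g′ , F′ , settled = solvable ch F in
          g′ , F′ , λ e → settle {A} {B} e (settled e)
      ; φ = φ ⊕ ψ
      ; φ-flow = flow-⊕ φ-flow F
      ; carries = carries′
      ; inside = inside′
      }
      where
      open Core C
      settle : ∀ {A B z z′} f → Settled A B z z′ (lab f) → Settled A B z z′ (circLab f)
      settle f st with ψ f ≟ 0ℤ
      ... | yes _ = st
      ... | no _  = tt
      carries′ : ∀ f → Carries (circLab f) (φ f + ψ f)
      carries′ f with ψ f ≟ 0ℤ
      ... | yes z = subst (Carries (lab f)) (sym (trans (cong (λ y → φ f + y) z) (+-identityʳ (φ f)))) (carries f)
      ... | no ¬z with todo? (lab f)
      ...   | no ¬todo = contradiction (proj₁ (inside f ¬todo)) (proj₁ (new f ¬z))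
      ...   | yes td with subst (λ l → Carries l (φ f)) td (carries f) | small f
      ...     | φ≡0 | inj₁ z = contradiction z ¬z
      ...     | φ≡0 | inj₂ u = subst Unit (sym (trans (cong (_+ ψ f) φ≡0) (+-identityˡ (ψ f)))) u
      inside′ : ∀ f → circLab f ≢ todo → src f ∈ U′ × tgt f ∈ U′
      inside′ f neq with ψ f ≟ 0ℤ
      ... | yes _ = let s , t = inside f neq in U⊆U′ s , U⊆U′ t
      ... | no ¬z = proj₂ (new f ¬z)

  -- The field `linked` says, in terms of closed sets, that `x₁` and `x₂` lie in one component of
  -- the support of `ψ`; other components are allowed and get cut away on attachment. The two ends
  -- may coincide, with `ψ` zero.
  record Ear (U : Subset (n G)) : Set where
    field
      {x₁ x₂ u₁ u₂} : V
      f₁ f₂  : E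
      f₁≢f₂  : f₁ ≢ f₂
      u₁∈    : u₁ ∈ U
      u₂∈    : u₂ ∈ U
      x₁∉    : x₁ ∉ U
      x₂∉    : x₂ ∉ U
      join₁  : Joins f₁ u₁ x₁
      join₂  : Joins f₂ u₂ x₂
      ψ      : Chain
      ψ-flow : Flow ψ
      small  : ∀ e → Small (ψ e)
      avoids : ∀ e → ψ e ≢ 0ℤ → src e ∉ U × tgt e ∉ U
      linked : ∀ S → (∀ e → ψ e ≢ 0ℤ → src e ∈ S → tgt e ∈ S) → (∀ e → ψ e ≢ 0ℤ → tgt e ∈ S → src e ∈ S) →
               x₁ ∈ S → x₂ ∈ S

  path-preserves : ∀ {Fw Bw} (P : V → Set) →
                   (∀ e → Fw e → P (src e) → P (tgt e)) → (∀ e → Bw e → P (tgt e) → P (src e)) →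
                   ∀ {x y} → Star (Arc Fw Bw) x y → P x → P y
  path-preserves P f b ε             px = px
  path-preserves P f b (fw e Fe ◅ r) px = path-preserves P f b r (f e Fe px)
  path-preserves P f b (bw e Be ◅ r) px = path-preserves P f b r (b e Be px)

  restrict : Subset (n G) → Chain → Chain
  restrict S ψ e with src e ∈? S
  ... | yes _ = ψ e
  ... | no _  = 0ℤ

  -- No edge of the support crosses `S`, so pairing the restriction with `π` is the same as pairing
  -- `ψ` with `π` set to 0 outside `S`.
  restrict-flow : ∀ S {ψ} → (∀ e → ψ e ≢ 0ℤ → src e ∈ S → tgt e ∈ S) → (∀ e → ψ e ≢ 0ℤ → tgt e ∈ S → src e ∈ S) →
                  Flow ψ → Flow (restrict S ψ)
  restrict-flow S {ψ} f b F = flow λ π → trans (sum-cong-≗ (term π)) (conserved F (πS π))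
    where
    πS : (V → ℤ) → V → ℤ
    πS π v with v ∈? S
    ... | yes _ = π v
    ... | no _  = 0ℤ
    term : ∀ π e → restrict S ψ e * diff π e ≡ ψ e * diff (πS π) e
    term π e with ψ e ≟ 0ℤ
    term π e | yes z with src e ∈? S
    ... | yes _ rewrite z = refl
    ... | no _  rewrite z = refl
    term π e | no ¬z with src e ∈? S | tgt e ∈? S
    ... | yes s | yes t = refl
    ... | no s  | no t  = sym (*-zeroʳ (ψ e))
    ... | yes s | no t  = contradiction (f e ¬z s) t
    ... | no s  | yes t = contradiction (b e ¬z t) s

  restrict-nonzero : ∀ S ψ e → restrict S ψ e ≢ 0ℤ → src e ∈ S × ψ e ≢ 0ℤ
  restrict-nonzero S ψ e nz with src e ∈? S
  ... | yes s = s , nz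
  ... | no _  = contradiction refl nz

  restrict-∈ : ∀ S ψ e → src e ∈ S → restrict S ψ e ≡ ψ e
  restrict-∈ S ψ e s with src e ∈? S
  ... | yes _ = refl
  ... | no ¬s = contradiction s ¬s

  restrict-small : ∀ S ψ → (∀ e → Small (ψ e)) → ∀ e → Small (restrict S ψ e)
  restrict-small S ψ sm e with src e ∈? S
  ... | yes _ = sm e
  ... | no _  = inj₁ refl

  joins-in : ∀ {e u x} {U : Subset (n G)} → Joins e u x → u ∈ U → x ∈ U → src e ∈ U × tgt e ∈ U
  joins-in (inj₁ (refl , refl)) u∈ x∈ = u∈ , x∈
  joins-in (inj₂ (refl , refl)) u∈ x∈ = x∈ , u∈

  joins-out : ∀ {e u x} {U : Subset (n G)} → Joins e u x → x ∉ U → ¬ (src e ∈ U × tgt e ∈ U)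
  joins-out (inj₁ (refl , refl)) x∉ (_ , t) = x∉ t
  joins-out (inj₂ (refl , refl)) x∉ (s , _) = x∉ s

  joins-meets : ∀ {e u x} {U : Subset (n G)} → Joins e u x → u ∈ U → ¬ (src e ∉ U × tgt e ∉ U)
  joins-meets (inj₁ (refl , refl)) u∈ (s , _) = s u∈
  joins-meets (inj₂ (refl , refl)) u∈ (_ , t) = t u∈

  record State (U : Subset (n G)) : Set₁ where
    field
      lab       : E → Label
      core      : Core U lab
      base      : V
      connected : Connected U lab base

  module _ {U : Subset (n G)} (st : State U) (ear : Ear U) where

    open State st
    open Core core
    open Ear ear

    private
      -- The component of `x₁` in the support of `ψ`. Only this part is added, so that all new
      -- vertices can be joined to `base` through `f₁`.
      R : Reach (λ e → ψ e ≢ 0ℤ) (λ e → ψ e ≢ 0ℤ) x₁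
      R = reach (λ e → ¬? (ψ e ≟ 0ℤ)) (λ e → ¬? (ψ e ≟ 0ℤ)) x₁

      open Reach R

      x₂∈S : x₂ ∈ S
      x₂∈S = linked S closed-fw closed-bw root

      ψS : Chain
      ψS = restrict S ψ

      new : ∀ e → ψS e ≢ 0ℤ → src e ∉ U × src e ∈ U ∪ S × tgt e ∈ U ∪ S
      new e nz = let s , nz′ = restrict-nonzero S ψ e nz in
        proj₁ (avoids e nz′) , q⊆p∪q U S s , q⊆p∪q U S (closed-fw e nz′ s)

      lab₁ lab₂ : E → Label
      lab₁ = circLab ψS lab
      lab₂ = pairLab f₁ f₂ lab₁

      core₁ : Core (U ∪ S) lab₁
      core₁ = circ-core ψS lab (restrict-flow S closed-fw closed-bw ψ-flow) (restrict-small S ψ small) (p⊆p∪q S) new core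

      -- The end of `f` in `U` keeps it out of the support of `ψ`; the end outside `U` shows that it
      -- had no label before.
      todo-lab₁ : ∀ {f u x} → Joins f u x → u ∈ U → x ∉ U → lab₁ f ≡ todo
      todo-lab₁ {f} j u∈ x∉ = trans (circLab-zero ψS lab f ψS≡0) lab≡todo
        where
        ψS≡0 : ψS f ≡ 0ℤ
        ψS≡0 with ψS f ≟ 0ℤ
        ... | yes z = z
        ... | no nz = ⊥-elim (joins-meets j u∈ (avoids f (proj₂ (restrict-nonzero S ψ f nz))))
        lab≡todo : lab f ≡ todo
        lab≡todo with todo? (lab f)
        ... | yes td = td
        ... | no ¬td = ⊥-elim (joins-out j x∉ (inside f ¬td))

      walk-S : ∀ {x} → x ∈ S → ∃ λ w → Bdry w x₁ x × (∀ e → lab₁ e ≡ todo → w e ≡ 0ℤ)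
      walk-S x∈ = let w , b , d , s = walk x∈ in w , b , λ e td → off (d e) (s e) (proj₁ (circLab-todo ψS lab e td))
        where
        off : ∀ {e z} → z ≡ 0ℤ ⊎ (z ≡ 1ℤ × ψ e ≢ 0ℤ) ⊎ (z ≡ -1ℤ × ψ e ≢ 0ℤ) →
              z ≡ 0ℤ ⊎ (src e ∈ S × tgt e ∈ S) → ψS e ≡ 0ℤ → z ≡ 0ℤ
        off (inj₁ z) _ _ = z
        off (inj₂ _) (inj₁ z) _ = z
        off {e} (inj₂ (inj₁ (_ , nz))) (inj₂ (s , _)) z = contradiction (trans (sym (restrict-∈ S ψ e s)) z) nz
        off {e} (inj₂ (inj₂ (_ , nz))) (inj₂ (s , _)) z = contradiction (trans (sym (restrict-∈ S ψ e s)) z) nz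

      walk-U : ∀ {x} → x ∈ U → ∃ λ w → Bdry w base x × (∀ e → lab₁ e ≡ todo → w e ≡ 0ℤ)
      walk-U x∈ = let w , b , z = connected x∈ in w , b , λ e td → z e (proj₂ (circLab-todo ψS lab e td))

      pair : Core (U ∪ S) lab₂
      pair = let
          c₁ , B₁ , z₁ = walk-U u₁∈
          s₁ , D₁ , unit₁ , o₁ = edge-walk join₁
          p , Q , zₚ = walk-S x₂∈S
          s₂ , D₂ , unit₂ , o₂ = edge-walk join₂
          c₂ , B₂ , z₂ = walk-U u₂∈
          W = closed-flow (bdry-trans (bdry-trans (bdry-trans (bdry-trans B₁ D₁) Q) (bdry-sym D₂)) (bdry-sym B₂))
          w = c₁ ⊕ s₁ ⊕ p ⊕ -1ℤ ⊙ s₂ ⊕ -1ℤ ⊙ c₂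
          val = λ f td → trans (cong₂ (λ a b → a + s₁ f + b + -1ℤ * s₂ f + -1ℤ * c₂ f) (z₁ f td) (zₚ f td))
                  (trans (cong (λ a → 0ℤ + s₁ f + 0ℤ + -1ℤ * s₂ f + -1ℤ * a) (z₂ f td)) (tidy (s₁ f) (s₂ f)))
          todo₁ = todo-lab₁ join₁ u₁∈ x₁∉
          todo₂ = todo-lab₁ join₂ u₂∈ x₂∉
        in pair-core f₁ f₂ lab₁ {w} W todo₁ todo₂
             (subst Unit (sym (trans (val f₁ todo₁) (trans (cong (λ a → s₁ f₁ - a) (o₂ f₁ (f₁≢f₂ ∘ sym))) (+-identityʳ (s₁ f₁))))) unit₁)
             (subst Unit (sym (trans (val f₂ todo₂) (trans (cong (_- s₂ f₂) (o₁ f₂ f₁≢f₂)) (+-identityˡ (- s₂ f₂))))) (neg-unit unit₂))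
             (λ f td p q → trans (val f td) (cong₂ _-_ (o₁ f p) (o₂ f q)))
             (joins-in join₁ (p⊆p∪q S u₁∈) (q⊆p∪q U S root))
             (joins-in join₂ (p⊆p∪q S u₂∈) (q⊆p∪q U S x₂∈S))
             core₁
        where
        tidy : ∀ a b → 0ℤ + a + 0ℤ + -1ℤ * b + -1ℤ * 0ℤ ≡ a - b
        tidy = solve-∀

      connected₂ : Connected (U ∪ S) lab₂ base
      connected₂ x∈ with x∈p∪q⁻ U S x∈
      ... | inj₁ x∈U = let w , b , z = walk-U x∈U in
        w , b , λ e td → z e (proj₂ (proj₂ (pairLab-todo f₁ f₂ lab₁ e td)))
      ... | inj₂ x∈S = let
          c₁ , B₁ , z₁ = walk-U u₁∈
          s₁ , D₁ , _ , o₁ = edge-walk join₁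
          p , Q , zₚ = walk-S x∈S
        in c₁ ⊕ s₁ ⊕ p , bdry-trans (bdry-trans B₁ D₁) Q , λ e td →
             let ≢₁ , _ , td₁ = pairLab-todo f₁ f₂ lab₁ e td in
             cong₂ _+_ (cong₂ _+_ (z₁ e td₁) (o₁ e ≢₁)) (zₚ e td₁)

    attach : ∃ λ U′ → U′ ⊃ U × State U′
    attach = U ∪ S , (p⊆p∪q S , x₁ , q⊆p∪q U S root , x₁∉) ,
      record { lab = lab₂ ; core = pair ; base = base ; connected = connected₂ }

  -- A single edge is handled as a pair whose two members coincide; `pairLab` then labels it
  -- `first`. Its circuit goes through `base`.
  close-chord : ∀ {U} (st : State U) e → src e ∈ U × tgt e ∈ U → State.lab st e ≡ todo → State U
  close-chord {U} st e (s , t) td = let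
      c₁ , B₁ , z₁ = connected s
      c₂ , B₂ , z₂ = connected t
      w = c₁ ⊕ δ e ⊕ -1ℤ ⊙ c₂
      W = closed-flow (bdry-trans (bdry-trans B₁ (bdry-δ e)) (bdry-sym B₂))
      unit = inj₁ (cong₂ (λ a b → a + b) (cong₂ _+_ (z₁ e td) (δ-refl e)) (cong (-1ℤ *_) (z₂ e td)))
    in record
      { lab = pairLab e e lab
      ; core = pair-core e e lab {w} W td td unit unit
          (λ f tf e≢f _ → cong₂ (λ a b → a + b) (cong₂ _+_ (z₁ f tf) (δ-≢ e≢f)) (cong (-1ℤ *_) (z₂ f tf)))
          (s , t) (s , t) core
      ; base = base
      ; connected = λ x∈ → let w , b , z = connected x∈ in
          w , b , λ f tf → z f (proj₂ (proj₂ (pairLab-todo e e lab f tf)))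
      }
    where open State st

  close-chords : ∀ {U} → (∀ v → v ∈ U) → State U → (es : List E) →
                 Σ (State U) λ st → ∀ e → e ∈ˡ es → State.lab st e ≢ todo
  close-chords all st []       = st , λ _ ()
  close-chords all st (e ∷ es) with close-chords all st es
  ... | st′ , done with todo? (State.lab st′ e)
  ...   | no ¬td = st′ , λ { f (here refl) → ¬td ; f (there f∈) → done f f∈ }
  ...   | yes td = close-chord st′ e (all (src e) , all (tgt e)) td , λ
    { f (here refl) eq → proj₁ (pairLab-todo e e (State.lab st′) f eq) refl
    ; f (there f∈) eq → done f f∈ (proj₂ (proj₂ (pairLab-todo e e (State.lab st′) f eq))) }

-- Existence of ears.

unit-odd : ∀ {z} → Unit z → ¬ (+ 2 ∣ z)
unit-odd (inj₁ refl) = from-no (+ 2 ∣? 1ℤ)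
unit-odd (inj₂ refl) = from-no (+ 2 ∣? -1ℤ)

∣z∣≤1⇒small : ∀ z → ∣ z ∣ ℕ.≤ 1 → Small z
∣z∣≤1⇒small (+ 0)      _ = inj₁ refl
∣z∣≤1⇒small (+ 1)      _ = inj₂ (inj₁ refl)
∣z∣≤1⇒small (+ ℕ.suc (ℕ.suc _)) (s≤s ())
∣z∣≤1⇒small -[1+ 0 ]   _ = inj₂ (inj₂ refl)
∣z∣≤1⇒small -[1+ ℕ.suc _ ] (s≤s ())

-- For an edge where two successive augmenting walks have coefficients `a` and `b`: by parity both
-- are zero or both nonzero, and in the latter case the second walk runs against the first.
residual-sum-even : ∀ {a b} → Small a → b ≡ 0ℤ ⊎ (b ≡ 1ℤ × a ≢ 1ℤ) ⊎ (b ≡ -1ℤ × a ≢ -1ℤ) →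
                    + 2 ∣ 0ℤ - (b + -1ℤ * a) → a + b ≡ 0ℤ
residual-sum-even (inj₁ refl)        (inj₁ refl) d = refl
residual-sum-even (inj₁ refl)        (inj₂ (inj₁ (refl , _))) d = contradiction d (unit-odd (inj₂ refl))
residual-sum-even (inj₁ refl)        (inj₂ (inj₂ (refl , _))) d = contradiction d (unit-odd (inj₁ refl))
residual-sum-even (inj₂ (inj₁ refl)) (inj₁ refl) d = contradiction d (unit-odd (inj₁ refl))
residual-sum-even (inj₂ (inj₁ refl)) (inj₂ (inj₁ (refl , ne))) d = contradiction refl ne
residual-sum-even (inj₂ (inj₁ refl)) (inj₂ (inj₂ (refl , _))) d = refl
residual-sum-even (inj₂ (inj₂ refl)) (inj₁ refl) d = contradiction d (unit-odd (inj₂ refl))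
residual-sum-even (inj₂ (inj₂ refl)) (inj₂ (inj₁ (refl , _))) d = refl
residual-sum-even (inj₂ (inj₂ refl)) (inj₂ (inj₂ (refl , ne))) d = contradiction refl ne

x∈p─q⇒x∉q : ∀ {k} (p q : Subset k) {x} → x ∈ p ─ q → x ∉ q
x∈p─q⇒x∉q (_ ∷ p) (_ ∷ q) ()         here
x∈p─q⇒x∉q (_ ∷ p) (_ ∷ q) (there x∈) (there x∈q) = x∈p─q⇒x∉q p q x∈ x∈q

AtMostOne : ∀ {A : Set} → (A → Set) → Set
AtMostOne P = ∀ {e f} → P e → P f → e ≡ f

module Ears (G : Graph) where

  open Chains G
  open Cuts G
  open Closure G

  Between : (P Q : V → Set) → E → Set
  Between P Q e = (P (src e) × Q (tgt e)) ⊎ (Q (src e) × P (tgt e))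

  between? : ∀ {P Q} → (∀ v → Dec (P v)) → (∀ v → Dec (Q v)) → ∀ e → Dec (Between P Q e)
  between? P? Q? e = (P? (src e) ×-dec Q? (tgt e)) ⊎-dec (Q? (src e) ×-dec P? (tgt e))

  Outside : (U B : Subset (n G)) → V → Set
  Outside U B v = v ∉ U × v ∉ B

  outside? : ∀ U B v → Dec (Outside U B v)
  outside? U B v = ¬? (v ∈? U) ×-dec ¬? (v ∈? B)

  _∖_ : (B S : Subset (n G)) → V → Set
  (B ∖ S) v = v ∈ B × v ∉ S

  ∈-stable : ∀ {v} {S : Subset (n G)} → ¬ (v ∉ S) → v ∈ S
  ∈-stable {v} {S} = decidable-stable (v ∈? S)

  -- The number of edges leaving a subset of B is at most one for S or for B ─ S: the edges between
  -- the two count for both, but the edge leaving B counts for only one of them.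
  split : ∀ {U B S} → (∀ {v} → v ∈ S → v ∈ B) → (∀ {v} → v ∈ B → v ∉ U) →
          AtMostOne (Between (_∈ B) (Outside U B)) → AtMostOne (Between (_∈ S) (B ∖ S)) →
          AtMostOne (Between (_∈ S) (Outside U S)) ⊎ AtMostOne (Between (_∈ B ─ S) (Outside U (B ─ S)))
  split {U} {B} {S} S⊆B B#U one-B one-S with any? (between? (_∈? S) (outside? U B))
  ... | no none = inj₁ λ p q → one-S (inner p) (inner q)
    where
    inner : ∀ {e} → Between (_∈ S) (Outside U S) e → Between (_∈ S) (B ∖ S) e
    inner {e} (inj₁ (s , (t∉U , t∉S))) = inj₁ (s , ∈-stable (λ t∉B → none (e , inj₁ (s , (t∉U , t∉B)))) , t∉S)
    inner {e} (inj₂ ((s∉U , s∉S) , t)) = inj₂ ((∈-stable (λ s∉B → none (e , inj₂ ((s∉U , s∉B) , t))) , s∉S) , t)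
  ... | yes (e₀ , b₀) = inj₂ λ p q → one-S (inner p) (inner q)
    where
    S⇒B : Between (_∈ S) (Outside U B) e₀ → Between (_∈ B) (Outside U B) e₀
    S⇒B (inj₁ (s , o)) = inj₁ (S⊆B s , o)
    S⇒B (inj₂ (o , t)) = inj₂ (o , S⊆B t)
    not-e₀ˡ : ∀ {e} → src e ∈ B → src e ∉ S → tgt e ∉ B → e ≡ e₀ → Between (_∈ S) (Outside U B) e₀ → ⊥
    not-e₀ˡ s∈B s∉S t∉B refl (inj₁ (s , _))         = s∉S s
    not-e₀ˡ s∈B s∉S t∉B refl (inj₂ ((_ , s∉B) , _)) = s∉B s∈B
    not-e₀ʳ : ∀ {e} → tgt e ∈ B → tgt e ∉ S → src e ∉ B → e ≡ e₀ → Between (_∈ S) (Outside U B) e₀ → ⊥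
    not-e₀ʳ t∈B t∉S s∉B refl (inj₂ (_ , t))         = t∉S t
    not-e₀ʳ t∈B t∉S s∉B refl (inj₁ (_ , (_ , t∉B))) = t∉B t∈B
    inner : ∀ {e} → Between (_∈ B ─ S) (Outside U (B ─ S)) e → Between (_∈ S) (B ∖ S) e
    inner {e} (inj₁ (s , (t∉U , t∉))) = inj₂ ((s∈B , s∉S) , ∈-stable λ t∉S →
      let t∉B = λ t∈B → t∉ (x∈p∧x∉q⇒x∈p─q t∈B t∉S)
      in not-e₀ˡ s∈B s∉S t∉B (one-B (inj₁ (s∈B , (t∉U , t∉B))) (S⇒B b₀)) b₀)
      where
      s∈B = p─q⊆p B S s
      s∉S = x∈p─q⇒x∉q B S s
    inner {e} (inj₂ ((s∉U , s∉) , t)) = inj₁ (∈-stable (λ s∉S →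
      let s∉B = λ s∈B → s∉ (x∈p∧x∉q⇒x∈p─q s∈B s∉S)
      in not-e₀ʳ t∈B t∉S s∉B (one-B (inj₂ ((s∉U , s∉B) , t∈B)) (S⇒B b₀)) b₀) , (t∈B , t∉S))
      where
      t∈B = p─q⊆p B S t
      t∉S = x∈p─q⇒x∉q B S t

  Within : Subset (n G) → E → Set
  Within B e = src e ∈ B × tgt e ∈ B

  within? : ∀ B e → Dec (Within B e)
  within? B e = src e ∈? B ×-dec tgt e ∈? B

  record Separator (B : Subset (n G)) (x y : V) : Set where
    field
      S    : Subset (n G)
      S⊆B  : ∀ {v} → v ∈ S → v ∈ B
      x∈   : x ∈ S
      y∉   : y ∉ S
      thin : AtMostOne (Between (_∈ S) (B ∖ S))

  -- This replaces two edge-disjoint paths from `x` to `y` inside `B` by a flow whose support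
  -- connects the two vertices.
  record Link (B : Subset (n G)) (x y : V) : Set where
    field
      ψ      : Chain
      ψ-flow : Flow ψ
      small  : ∀ e → Small (ψ e)
      within : ∀ e → ψ e ≢ 0ℤ → Within B e
      linked : ∀ S → (∀ e → ψ e ≢ 0ℤ → src e ∈ S → tgt e ∈ S) → (∀ e → ψ e ≢ 0ℤ → tgt e ∈ S → src e ∈ S) →
               x ∈ S → y ∈ S

  module _ {B : Subset (n G)} {x y : V} (x∈B : x ∈ B) where

    -- From a flow w₁ + w₂ of value 2 with values in {-1, 0, 1}, the flow w₂ - w₁ is closed and has
    -- the same parity, so its reduction modulo 2 has the same support.
    link : ∀ {w₁ w₂} → Bdry w₁ x y → Directed (Within B) (Within B) w₁ → Bdry w₂ x y →
           Directed (λ e → Within B e × w₁ e ≢ 1ℤ) (λ e → Within B e × w₁ e ≢ -1ℤ) w₂ → Link B x y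
    link {w₁} {w₂} b₁ d₁ b₂ d₂ = record
      { ψ = ψ ; ψ-flow = proj₁ (proj₂ red) ; small = small ; within = within ; linked = linked }
      where
      red = reduce 1 (closed-flow (bdry-trans b₂ (bdry-sym b₁)))
      ψ   = proj₁ red
      even : ∀ e → + 2 ∣ ψ e - (w₂ e + -1ℤ * w₁ e)
      even = proj₁ (proj₂ (proj₂ red))
      small : ∀ e → Small (ψ e)
      small e = ∣z∣≤1⇒small (ψ e) (proj₂ (proj₂ (proj₂ red)) e)
      within : ∀ e → ψ e ≢ 0ℤ → Within B e
      within e nz with d₁ e | d₂ e | small e
      ... | inj₂ (inj₁ (_ , i)) | _ | _ = i
      ... | inj₂ (inj₂ (_ , i)) | _ | _ = i
      ... | inj₁ _ | inj₂ (inj₁ (_ , (i , _))) | _ = i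
      ... | inj₁ _ | inj₂ (inj₂ (_ , (i , _))) | _ = i
      ... | inj₁ _ | inj₁ _ | inj₁ z = contradiction z nz
      ... | inj₁ z₁ | inj₁ z₂ | inj₂ u = contradiction
        (subst (+ 2 ∣_) (trans (cong₂ (λ a b → ψ e - (b + -1ℤ * a)) z₁ z₂) (+-identityʳ (ψ e))) (even e)) (unit-odd u)
      small₁ : ∀ e → Small (w₁ e)
      small₁ e with d₁ e
      ... | inj₁ z              = inj₁ z
      ... | inj₂ (inj₁ (z , _)) = inj₂ (inj₁ z)
      ... | inj₂ (inj₂ (z , _)) = inj₂ (inj₂ z)
      residual : ∀ e → w₂ e ≡ 0ℤ ⊎ (w₂ e ≡ 1ℤ × w₁ e ≢ 1ℤ) ⊎ (w₂ e ≡ -1ℤ × w₁ e ≢ -1ℤ)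
      residual e with d₂ e
      ... | inj₁ z                        = inj₁ z
      ... | inj₂ (inj₁ (z , (_ , ne))) = inj₂ (inj₁ (z , ne))
      ... | inj₂ (inj₂ (z , (_ , ne))) = inj₂ (inj₂ (z , ne))
      linked : ∀ S → (∀ e → ψ e ≢ 0ℤ → src e ∈ S → tgt e ∈ S) → (∀ e → ψ e ≢ 0ℤ → tgt e ∈ S → src e ∈ S) →
               x ∈ S → y ∈ S
      -- If `y` were outside `S`, the chain `w₁ ⊕ w₂` would carry 2 out of `S`. But it vanishes off
      -- the support of `ψ`, and no edge of that support crosses `S`.
      linked S f b x∈S = ∈-stable λ y∉S → contradiction (value y∉S) (λ ())
        where
        term : ∀ e → (w₁ e + w₂ e) * diff (ind S) e ≡ 0ℤ
        term e with ψ e ≟ 0ℤ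
        ... | yes z = cong (_* diff (ind S) e)
          (residual-sum-even (small₁ e) (residual e) (subst (λ a → + 2 ∣ a - (w₂ e + -1ℤ * w₁ e)) z (even e)))
        ... | no nz with cutView S e
        ...   | inj₁ (_ , _ , d) = trans (cong ((w₁ e + w₂ e) *_) d) (*-zeroʳ (w₁ e + w₂ e))
        ...   | inj₂ (inj₁ ((s , t) , _)) = contradiction (f e nz s) t
        ...   | inj₂ (inj₂ ((s , t) , _)) = contradiction (b e nz t) s
        value : y ∉ S → 0ℤ ≡ - + 2
        value y∉S = begin
          0ℤ                                                ≡⟨ sym (sum-zero (λ e → (w₁ e + w₂ e) * diff (ind S) e) term) ⟩
          ⟪ w₁ ⊕ w₂ , ind S ⟫                               ≡⟨ ⟪⟫-⊕ w₁ w₂ (ind S) ⟩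
          ⟪ w₁ , ind S ⟫ + ⟪ w₂ , ind S ⟫                   ≡⟨ cong₂ _+_ (telescope b₁ (ind S)) (telescope b₂ (ind S)) ⟩
          (ind S y - ind S x) + (ind S y - ind S x)         ≡⟨ cong₂ (λ a c → (a - c) + (a - c)) (ind-∉ y∉S) (ind-∈ x∈S) ⟩
          - + 2                                             ∎
          where open ≡-Reasoning

    -- Inside `B`, every edge between `S` and the rest carries 1 out of `S`, since otherwise the
    -- residual search would have crossed it. The net flow of `w₁` out of `S` is 1, so there is at
    -- most one such edge; `h e` is the contribution of `e` to this net flow.
    residual-separator : ∀ {w₁} → Bdry w₁ x y → Directed (Within B) (Within B) w₁ →
      (R : Reach (λ e → Within B e × w₁ e ≢ 1ℤ) (λ e → Within B e × w₁ e ≢ -1ℤ) x) →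
      y ∉ Reach.S R → Separator B x y
    residual-separator {w₁} b₁ d₁ R y∉ = record
      { S = S
      ; S⊆B = S⊆B
      ; x∈ = root
      ; y∉ = y∉
      ; thin = thin
      }
      where
      open Reach R
      h : E → ℤ
      h e = -1ℤ * w₁ e * diff (ind S) e
      saturated-out : ∀ e → Within B e → src e ∈ S → tgt e ∉ S → w₁ e ≡ 1ℤ
      saturated-out e i s t = decidable-stable (w₁ e ≟ 1ℤ) (λ ne → t (closed-fw e (i , ne) s))
      saturated-in : ∀ e → Within B e → src e ∉ S → tgt e ∈ S → w₁ e ≡ -1ℤ
      saturated-in e i s t = decidable-stable (w₁ e ≟ -1ℤ) (λ ne → s (closed-bw e (i , ne) t))
      h-out : ∀ e → Within B e → src e ∈ S → tgt e ∉ S → h e ≡ 1ℤ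
      h-out e i s t = cong₂ (λ a b → -1ℤ * a * b) (saturated-out e i s t) (cong₂ _-_ (ind-∉ t) (ind-∈ s))
      h-in : ∀ e → Within B e → src e ∉ S → tgt e ∈ S → h e ≡ 1ℤ
      h-in e i s t = cong₂ (λ a b → -1ℤ * a * b) (saturated-in e i s t) (cong₂ _-_ (ind-∈ t) (ind-∉ s))
      h-off : ∀ e → ¬ Within B e → h e ≡ 0ℤ
      h-off e ¬i with d₁ e
      ... | inj₁ z              = cong (λ a → -1ℤ * a * diff (ind S) e) z
      ... | inj₂ (inj₁ (_ , i)) = contradiction i ¬i
      ... | inj₂ (inj₂ (_ , i)) = contradiction i ¬i
      0≤h : ∀ e → 0ℤ ≤ h e
      0≤h e with within? B e
      ... | no ¬i = ≤-reflexive (sym (h-off e ¬i))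
      ... | yes i with cutView S e
      ...   | inj₁ (_ , _ , d) = ≤-reflexive (sym (trans (cong (-1ℤ * w₁ e *_) d) (*-zeroʳ (-1ℤ * w₁ e))))
      ...   | inj₂ (inj₁ ((s , t) , _)) = subst (0ℤ ≤_) (sym (h-out e i s t)) (+≤+ z≤n)
      ...   | inj₂ (inj₂ ((s , t) , _)) = subst (0ℤ ≤_) (sym (h-in e i s t)) (+≤+ z≤n)
      S⊆B : ∀ {v} → v ∈ S → v ∈ B
      S⊆B v∈ = path-preserves (_∈ B) (λ _ i _ → proj₂ (proj₁ i)) (λ _ i _ → proj₁ (proj₁ i)) (path v∈) x∈B
      1≤h : ∀ {e} → Between (_∈ S) (B ∖ S) e → 1ℤ ≤ h e
      1≤h {e} (inj₁ (s , (t∈B , t))) = ≤-reflexive (sym (h-out e (S⊆B s , t∈B) s t))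
      1≤h {e} (inj₂ ((s∈B , s) , t)) = ≤-reflexive (sym (h-in e (s∈B , S⊆B t) s t))
      total : sum h ≡ 1ℤ
      total = trans (telescope (bdry-sym b₁) (ind S)) (cong₂ _-_ (ind-∈ root) (ind-∉ y∉))
      thin : AtMostOne (Between (_∈ S) (B ∖ S))
      thin {e} {f} p q = decidable-stable (e ≟ᶠ f) λ e≢f →
        contradiction (subst (+ 2 ≤_) total (sum-pos₂ {h = h} e≢f 0≤h (1≤h p) (1≤h q))) λ { (+≤+ (s≤s ())) }

    -- The two augmentation steps of Menger's theorem for two edge-disjoint paths.
    link-or-separate : Link B x y ⊎ Separator B x y
    link-or-separate = first-step (reach (within? B) (within? B) x)
      where
      second-step : ∀ {w₁} → Bdry w₁ x y → Directed (Within B) (Within B) w₁ →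
                    Reach (λ e → Within B e × w₁ e ≢ 1ℤ) (λ e → Within B e × w₁ e ≢ -1ℤ) x → Link B x y ⊎ Separator B x y
      second-step b₁ d₁ R with y ∈? Reach.S R
      ... | yes y∈ = let w₂ , b₂ , d₂ , _ = Reach.walk R y∈ in inj₁ (link b₁ d₁ b₂ d₂)
      ... | no y∉  = inj₂ (residual-separator b₁ d₁ R y∉)
      first-step : Reach (Within B) (Within B) x → Link B x y ⊎ Separator B x y
      first-step R with y ∈? Reach.S R
      ... | yes y∈ = let w₁ , b₁ , d₁ , _ = Reach.walk R y∈ in
        -- In the residual graph an edge may not be used again in the direction in which `w₁`
        -- already uses it.
        second-step b₁ d₁ (reach (λ e → within? B e ×-dec ¬? (w₁ e ≟ 1ℤ)) (λ e → within? B e ×-dec ¬? (w₁ e ≟ -1ℤ)) x)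
      ... | no y∉ = inj₂ record
        { S = S ; S⊆B = S⊆B ; x∈ = root ; y∉ = y∉ ; thin = λ p _ → ⊥-elim (uncut p) }
        where
        open Reach R
        S⊆B : ∀ {v} → v ∈ S → v ∈ B
        S⊆B v∈ = path-preserves (_∈ B) (λ _ i _ → proj₂ i) (λ _ i _ → proj₁ i) (path v∈) x∈B
        uncut : ∀ {e} → ¬ Between (_∈ S) (B ∖ S) e
        uncut {e} (inj₁ (s , (t∈B , t∉))) = t∉ (closed-fw e (S⊆B s , t∈B) s)
        uncut {e} (inj₂ ((s∈B , s∉) , t)) = s∉ (closed-bw e (s∈B , S⊆B t) t)

  module _ (conn : EdgeConnected 3 G) {U : Subset (n G)} {u₀ : V} (u₀∈U : u₀ ∈ U) where

    Exit : Subset (n G) → List E → Set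
    Exit B F = ∃ λ f → ¬ (f ∈ˡ F) × ∃ λ u → ∃ λ x → u ∈ U × x ∈ B × Joins f u x

    -- Three-edge-connectivity gives an edge out of `B` that is not in `F`. All edges from `B` to
    -- vertices outside both `U` and `B` are in `F`, so this one ends in `U`.
    exit : ∀ {B b} → b ∈ B → (∀ {v} → v ∈ B → v ∉ U) → ∀ F → length F ℕ.< 3 →
           (∀ e → Between (_∈ B) (Outside U B) e → e ∈ˡ F) → Exit B F
    exit {B} {b} b∈ B#U F F<3 covers with crossing (conn F F<3 b u₀) b∈ (λ u₀∈B → B#U u₀∈B u₀∈U)
    ... | f , f∉ , inj₁ (s , t) = f , f∉ , tgt f , src f ,
      ∈-stable (λ t∉U → f∉ (covers f (inj₁ (s , (t∉U , t))))) , s , inj₂ (refl , refl)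
    ... | f , f∉ , inj₂ (s , t) = f , f∉ , src f , tgt f ,
      ∈-stable (λ s∉U → f∉ (covers f (inj₂ ((s∉U , s) , t)))) , t , inj₁ (refl , refl)

    -- At most one edge joins `B` to the rest outside `U`. Even after removing it and a first edge
    -- to `U`, fewer than three edges are gone, so there is a second edge to `U`. If their ends in
    -- `B` are not linked, a separator divides `B`, and by `split` one part inherits the condition
    -- and is nonempty and smaller.
    find-ear : ∀ B → Acc _⊂_ B → ∀ {b} → b ∈ B → (∀ {v} → v ∈ B → v ∉ U) →
               AtMostOne (Between (_∈ B) (Outside U B)) → Ear U
    find-ear B (acc rec) {b} b∈ B#U one = from-cover cover
      where
      Cover : Set
      Cover = ∃ λ F → length F ℕ.≤ 1 × (∀ e → Between (_∈ B) (Outside U B) e → e ∈ˡ F)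

      cover : Cover
      cover with any? (between? (_∈? B) (outside? U B))
      ... | yes (e₀ , b₀) = e₀ ∷ [] , s≤s z≤n , λ e p → here (one p b₀)
      ... | no none       = [] , z≤n , λ e p → ⊥-elim (none (e , p))

      from-exits : ∀ {f₁ f₂ u₁ u₂ x₁ x₂} → f₁ ≢ f₂ → u₁ ∈ U → u₂ ∈ U → x₁ ∈ B → x₂ ∈ B →
                   Joins f₁ u₁ x₁ → Joins f₂ u₂ x₂ → Link B x₁ x₂ → Ear U
      from-exits f₁≢f₂ u₁∈ u₂∈ x₁∈ x₂∈ j₁ j₂ L = record
        { f₁≢f₂ = f₁≢f₂ ; u₁∈ = u₁∈ ; u₂∈ = u₂∈ ; x₁∉ = B#U x₁∈ ; x₂∉ = B#U x₂∈ ; join₁ = j₁ ; join₂ = j₂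
        ; ψ = ψ ; ψ-flow = ψ-flow ; small = small ; linked = linked
        ; avoids = λ e nz → let s , t = within e nz in B#U s , B#U t }
        where open Link L

      descend : ∀ {x y} → y ∈ B → Separator B x y → Ear U
      descend {x} {y} y∈B sep with split S⊆B B#U one thin
        where open Separator sep
      ... | inj₁ one-S = find-ear S (rec (S⊆B , y , y∈B , y∉)) x∈ (λ v∈ → B#U (S⊆B v∈)) one-S
        where open Separator sep
      ... | inj₂ one-D = find-ear (B ─ S) (rec (p∩q≢∅⇒p─q⊂p B S (x , x∈p∩q⁺ (S⊆B x∈ , x∈))))
                           (x∈p∧x∉q⇒x∈p─q y∈B y∉) (λ v∈ → B#U (p─q⊆p B S v∈)) one-D
        where open Separator sep

      from-cover : Cover → Ear U
      from-cover (F , F≤1 , covers)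
        with exit b∈ B#U F (s≤s (ℕ.m≤n⇒m≤1+n F≤1)) covers
      ... | f₁ , _ , u₁ , x₁ , u₁∈ , x₁∈ , j₁
        with exit b∈ B#U (f₁ ∷ F) (s≤s (s≤s F≤1)) (λ e p → there (covers e p))
      ... | f₂ , f₂∉ , u₂ , x₂ , u₂∈ , x₂∈ , j₂
        with link-or-separate {B} {x₁} {x₂} x₁∈
      ... | inj₁ L   = from-exits (λ eq → f₂∉ (here (sym eq))) u₁∈ u₂∈ x₁∈ x₂∈ j₁ j₂ L
      ... | inj₂ sep = descend x₂∈ sep

-- Arithmetic of the adjustments along circuits and of the final combinations.

NonZeroℤ Indivisible : ℤ → Set
NonZeroℤ z    = z ≢ 0ℤ
Indivisible z = ¬ (+ 3 ∣ z)

swap-choosable : ∀ {A B} → Choosable A B → Choosable B A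
swap-choosable ch p q s r = let t , b , a = ch q p r s in t , a , b

hits : ∀ p {s} → Unit s → ∀ v → p + s * (v - p) * s ≡ v
hits p (inj₁ refl) v = forward p v
  where
  forward : ∀ p v → p + 1ℤ * (v - p) * 1ℤ ≡ v
  forward = solve-∀
hits p (inj₂ refl) v = backward p v
  where
  backward : ∀ p v → p + -1ℤ * (v - p) * -1ℤ ≡ v
  backward = solve-∀

-- As `s * s = 1`, the first value can be moved to 1 or to -1. The two resulting second values
-- differ by `s * r * + 2`, so they are not both zero.
choose-unit : Choosable Unit NonZeroℤ
choose-unit p q {s} {r} us ur with q + s * (1ℤ - p) * r ≟ 0ℤ
... | no ≢0  = s * (1ℤ - p) , inj₁ (hits p us 1ℤ) , ≢0
... | yes ≡0 = s * (-1ℤ - p) , inj₂ (hits p us -1ℤ) , λ ≡0′ →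
  apart us ur (trans (sym (gap p q s r)) (cong₂ _-_ ≡0 ≡0′))
  where
  gap : ∀ p q s r → (q + s * (1ℤ - p) * r) - (q + s * (-1ℤ - p) * r) ≡ s * r * + 2
  gap = solve-∀
  apart : ∀ {s r} → Unit s → Unit r → s * r * + 2 ≢ 0ℤ
  apart (inj₁ refl) (inj₁ refl) ()
  apart (inj₁ refl) (inj₂ refl) ()
  apart (inj₂ refl) (inj₁ refl) ()
  apart (inj₂ refl) (inj₂ refl) ()

unit∤₃ : ∀ {s} → Unit s → Indivisible (1ℤ * s) × Indivisible (-1ℤ * s) × Indivisible (+ 2 * s)
unit∤₃ (inj₁ refl) = from-no (+ 3 ∣? 1ℤ) , from-no (+ 3 ∣? -1ℤ) , from-no (+ 3 ∣? + 2)
unit∤₃ (inj₂ refl) = from-no (+ 3 ∣? -1ℤ) , from-no (+ 3 ∣? 1ℤ) , from-no (+ 3 ∣? - + 2)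

-- Both `t = 1` and `t = -1` move `p` off the multiples of 3. The values `q + r` and `q - r` differ
-- by `+ 2 * r`, so 3 does not divide both.
choose-off-multiple : ∀ {p s r} → + 3 ∣ p → ∀ q → Unit s → Unit r →
                      ∃ λ t → Indivisible (p + t * s) × Indivisible (q + t * r)
choose-off-multiple {p} {s} {r} 3∣p q us ur with + 3 ∣? q + 1ℤ * r
... | no 3∤  = 1ℤ , (λ d → proj₁ (unit∤₃ us) (∣m+n∣m⇒∣n d 3∣p)) , 3∤
... | yes 3∣ = -1ℤ , (λ d → proj₁ (proj₂ (unit∤₃ us)) (∣m+n∣m⇒∣n d 3∣p)) ,
  λ d → proj₂ (proj₂ (unit∤₃ ur)) (subst (+ 3 ∣_) (gap q r) (∣m∣n⇒∣m-n 3∣ d))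
  where
  gap : ∀ q r → (q + 1ℤ * r) - (q + -1ℤ * r) ≡ + 2 * r
  gap = solve-∀

choose-indivisible : Choosable Indivisible Indivisible
choose-indivisible p q us ur with + 3 ∣? p | + 3 ∣? q
... | yes 3∣p | _      = choose-off-multiple 3∣p q us ur
... | no _    | yes 3∣q = let t , b , a = choose-off-multiple 3∣q p ur us in t , a , b
... | no 3∤p  | no 3∤q = 0ℤ , subst Indivisible (sym (+-identityʳ p)) 3∤p , subst Indivisible (sym (+-identityʳ q)) 3∤q

dominated : ∀ {z N y} → ∣ z ∣ ℕ.< N → Unit y → z + + N * y ≢ 0ℤ
dominated {z} {N} {y} z<N u eq = ℕ.<⇒≢ z<N (begin
  ∣ z ∣              ≡⟨ cong ∣_∣ (i-j≡0⇒i≡j z (- (+ N * y)) (trans (cong (λ a → z + a) (neg-involutive (+ N * y))) eq)) ⟩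
  ∣ - (+ N * y) ∣    ≡⟨ ∣-i∣≡∣i∣ (+ N * y) ⟩
  ∣ + N * y ∣        ≡⟨ abs-* (+ N) y ⟩
  N ℕ.* ∣ y ∣        ≡⟨ cong (N ℕ.*_) (unit-abs u) ⟩
  N ℕ.* 1            ≡⟨ ℕ.*-identityʳ N ⟩
  N                  ∎)
  where
  open ≡-Reasoning
  unit-abs : ∀ {y} → Unit y → ∣ y ∣ ≡ 1
  unit-abs (inj₁ refl) = refl
  unit-abs (inj₂ refl) = refl

Covers : ℤ → ℤ → Set
Covers y z = (+ 3 * y + + 2 * z ≢ 0ℤ × + 3 * y + - + 2 * z ≢ 0ℤ × 1ℤ * y + + 2 * z ≢ 0ℤ) ×
             (Unit (+ 3 * y + + 2 * z) ⊎ Unit (+ 3 * y + - + 2 * z) ⊎ Unit (1ℤ * y + + 2 * z))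

-- All three values are odd, hence nonzero. For `z = 0` the last one is `y`. Otherwise twice the
-- absolute value of `z` is 2 or 4, at distance 1 from 3, and the sign that opposes the two terms
-- gives 1 or -1.
covers : ∀ {y} z → Unit y → ∣ z ∣ ℕ.≤ 2 → Covers y z
covers (+ 0)    (inj₁ refl) _ = ((λ ()) , (λ ()) , (λ ())) , inj₂ (inj₂ (inj₁ refl))
covers (+ 1)    (inj₁ refl) _ = ((λ ()) , (λ ()) , (λ ())) , inj₂ (inj₁ (inj₁ refl))
covers (+ 2)    (inj₁ refl) _ = ((λ ()) , (λ ()) , (λ ())) , inj₂ (inj₁ (inj₂ refl))
covers -[1+ 0 ] (inj₁ refl) _ = ((λ ()) , (λ ()) , (λ ())) , inj₁ (inj₁ refl)
covers -[1+ 1 ] (inj₁ refl) _ = ((λ ()) , (λ ()) , (λ ())) , inj₁ (inj₂ refl)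
covers (+ 0)    (inj₂ refl) _ = ((λ ()) , (λ ()) , (λ ())) , inj₂ (inj₂ (inj₂ refl))
covers (+ 1)    (inj₂ refl) _ = ((λ ()) , (λ ()) , (λ ())) , inj₁ (inj₂ refl)
covers (+ 2)    (inj₂ refl) _ = ((λ ()) , (λ ()) , (λ ())) , inj₁ (inj₁ refl)
covers -[1+ 0 ] (inj₂ refl) _ = ((λ ()) , (λ ()) , (λ ())) , inj₂ (inj₁ (inj₂ refl))
covers -[1+ 1 ] (inj₂ refl) _ = ((λ ()) , (λ ()) , (λ ())) , inj₂ (inj₁ (inj₁ refl))
covers (+ ℕ.suc (ℕ.suc (ℕ.suc _))) _ (s≤s (s≤s ()))
covers -[1+ ℕ.suc (ℕ.suc _) ] _ (s≤s (s≤s ()))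

scaled-nonzero : ∀ {y z} a {b} → b ≢ 0ℤ → y ≡ 0ℤ → z ≢ 0ℤ → a * y + b * z ≢ 0ℤ
scaled-nonzero {z = z} a {b} b≢0 refl z≢0 eq rewrite *-zeroʳ a | +-identityˡ (b * z) =
  [ b≢0 , z≢0 ]′ (i*j≡0⇒i≡0∨j≡0 b eq)

module Frank (G : Graph) (conn : EdgeConnected 3 G) where

  open Chains G
  open Cuts G
  open Closure G
  open Ears G

  grow : ∀ U → Acc _⊃_ U → ∀ {u} → u ∈ U → State U → ∃ λ U′ → (∀ v → v ∈ U′) × State U′
  grow U (acc rec) u∈ st with any? (λ v → ¬? (v ∈? U))
  ... | no none = U , (λ v → decidable-stable (v ∈? U) (λ v∉ → none (v , v∉))) , st
  ... | yes (b , b∉) =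
    -- The search starts with the whole complement of `U`; no vertex is outside both, so the bound
    -- on outgoing edges holds vacuously.
    let U′ , U′⊃U , st′ = attach st (find-ear conn u∈ (∁ U) (⊂-wellFounded (∁ U)) (x∉p⇒x∈∁p b∉) x∈∁p⇒x∉p
          (λ { (inj₁ (_ , (t∉ , t∉∁))) _ → contradiction (x∉p⇒x∈∁p t∉) t∉∁
             ; (inj₂ ((s∉ , s∉∁) , _)) _ → contradiction (x∉p⇒x∈∁p s∉) s∉∁ }))
    in grow U′ (rec U′⊃U) (proj₁ U′⊃U u∈) st′

  initial : ∀ v → State ⁅ v ⁆
  initial v = record
    { lab = λ _ → todo
    ; core = record
      { solvable = λ _ {g} F → g , F , λ _ → refl
      ; φ = λ _ → 0ℤ
      ; φ-flow = zero-flow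
      ; carries = λ _ → refl
      ; inside = λ _ ≢todo → contradiction refl ≢todo
      }
    ; base = v
    ; connected = λ x∈ → subst (λ x → ∃ λ w → Bdry w v x × (∀ _ → todo ≡ todo → w _ ≡ 0ℤ))
        (sym (x∈⁅y⁆⇒x≡y v x∈)) ((λ _ → 0ℤ) , bdry-nil v , λ _ _ → refl)
    }

  module _ {U lab} (C : Core U lab) (done : ∀ e → lab e ≢ todo) where

    open Core C

    -- One more than the sum of all absolute values exceeds each of them, so on the support of `φ`
    -- this multiple of `φ` cannot be cancelled by `g`.
    scale : Chain → ℤ
    scale g = + ℕ.suc (ℕΣ.sum (λ e → ∣ g e ∣))

    boosted : Chain → Chain
    boosted g = g ⊕ scale g ⊙ φ

    boosted-off : ∀ g e → φ e ≡ 0ℤ → boosted g e ≡ g e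
    boosted-off g e z = trans (cong (λ a → g e + scale g * a) z)
      (trans (cong (λ a → g e + a) (*-zeroʳ (scale g))) (+-identityʳ (g e)))

    boosted-nonzero : ∀ {A B} → (∀ {z} → A z → z ≢ 0ℤ) → (∀ {z} → B z → z ≢ 0ℤ) →
                      ∀ g → (∀ e → Settled A B 0ℤ (g e) (lab e)) → ∀ e → boosted g e ≢ 0ℤ
    boosted-nonzero A≢0 B≢0 g settled e with lab e | done e | settled e | carries e
    ... | todo   | nt | _ | _ = contradiction refl nt
    ... | first  | _  | a | z = subst (_≢ 0ℤ) (sym (boosted-off g e z)) (A≢0 a)
    ... | second | _  | b | z = subst (_≢ 0ℤ) (sym (boosted-off g e z)) (B≢0 b)
    ... | circ   | _  | _ | u = dominated {g e} (s≤s (≤ℕsum (λ e → ∣ g e ∣) e)) u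

    unit≢0 : ∀ {z} → Unit z → z ≢ 0ℤ
    unit≢0 (inj₁ refl) ()
    unit≢0 (inj₂ refl) ()

    frank : FrankNumber≤ G 5
    frank with solvable {Unit} {NonZeroℤ} choose-unit zero-flow | solvable (swap-choosable {Unit} {NonZeroℤ} choose-unit) zero-flow
             | solvable {Indivisible} {Indivisible} choose-indivisible zero-flow
    -- The argument 2 of `reduce` means reduction modulo 3 to absolute values at most 2, as `covers`
    -- requires.
    ... | a , A , a-settled | b , B , b-settled | h , H , h-settled with reduce 2 H
    ...   | g , G′ , g≡h , g≤2 =
      (λ i → orient (flows i)) , (λ i → strongly-connected conn (is-flow i) (nonzero i)) , deletable-somewhere
      where
      flows : Fin 5 → Chain
      flows 0F = boosted a
      flows 1F = boosted b
      flows 2F = + 3 ⊙ φ ⊕ + 2 ⊙ g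
      flows 3F = + 3 ⊙ φ ⊕ - + 2 ⊙ g
      flows 4F = 1ℤ ⊙ φ ⊕ + 2 ⊙ g

      is-flow : ∀ i → Flow (flows i)
      is-flow 0F = flow-⊕ A (flow-⊙ (scale a) φ-flow)
      is-flow 1F = flow-⊕ B (flow-⊙ (scale b) φ-flow)
      is-flow 2F = flow-⊕ (flow-⊙ (+ 3) φ-flow) (flow-⊙ (+ 2) G′)
      is-flow 3F = flow-⊕ (flow-⊙ (+ 3) φ-flow) (flow-⊙ (- + 2) G′)
      is-flow 4F = flow-⊕ (flow-⊙ 1ℤ φ-flow) (flow-⊙ (+ 2) G′)

      g-nonzero : ∀ e → Indivisible (h e) → g e ≢ 0ℤ
      g-nonzero e 3∤h g≡0 = 3∤h (subst (+ 3 ∣_) (cancel (g e) (h e))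
        (∣m∣n⇒∣m-n (subst (+ 3 ∣_) (sym g≡0) (divides 0ℤ refl)) (g≡h e)))
        where
        cancel : ∀ x y → x - (x - y) ≡ y
        cancel = solve-∀

      off-or-on : ∀ e → (φ e ≡ 0ℤ × g e ≢ 0ℤ) ⊎ Unit (φ e)
      off-or-on e with lab e | done e | h-settled e | carries e
      ... | todo   | nt | _ | _ = contradiction refl nt
      ... | first  | _  | d | z = inj₁ (z , g-nonzero e d)
      ... | second | _  | d | z = inj₁ (z , g-nonzero e d)
      ... | circ   | _  | _ | u = inj₂ u

      combination : ∀ x y → y ≢ 0ℤ → (∀ e → Unit (φ e) → x * φ e + y * g e ≢ 0ℤ) → ∀ e → x * φ e + y * g e ≢ 0ℤ
      combination x y y≢0 on e with off-or-on e
      ... | inj₁ (φ≡0 , g≢0) = scaled-nonzero x y≢0 φ≡0 g≢0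
      ... | inj₂ u           = on e u

      nonzero : ∀ i e → flows i e ≢ 0ℤ
      nonzero 0F = boosted-nonzero unit≢0 (λ z → z) a a-settled
      nonzero 1F = boosted-nonzero (λ z → z) unit≢0 b b-settled
      nonzero 2F = combination (+ 3) (+ 2) (λ ()) λ e u → proj₁ (proj₁ (covers (g e) u (g≤2 e)))
      nonzero 3F = combination (+ 3) (- + 2) (λ ()) λ e u → proj₁ (proj₂ (proj₁ (covers (g e) u (g≤2 e))))
      nonzero 4F = combination 1ℤ (+ 2) (λ ()) λ e u → proj₂ (proj₂ (proj₁ (covers (g e) u (g≤2 e))))

      unit-somewhere : ∀ e → ∃ λ i → Unit (flows i e)
      unit-somewhere e with lab e | done e | a-settled e | b-settled e | carries e
      ... | todo   | nt | _ | _ | _ = contradiction refl nt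
      ... | first  | _  | u | _ | z = 0F , subst Unit (sym (boosted-off a e z)) u
      ... | second | _  | _ | u | z = 1F , subst Unit (sym (boosted-off b e z)) u
      ... | circ   | _  | _ | _ | u with proj₂ (covers (g e) u (g≤2 e))
      ...   | inj₁ u₂        = 2F , u₂
      ...   | inj₂ (inj₁ u₃) = 3F , u₃
      ...   | inj₂ (inj₂ u₄) = 4F , u₄

      deletable-somewhere : ∀ e → ∃ λ i → Deletable G (orient (flows i)) e
      deletable-somewhere e = let i , u = unit-somewhere e in i , deletable conn (is-flow i) (nonzero i) e u

  frank-from-vertex : V → FrankNumber≤ G 5
  frank-from-vertex v =
    let _ , all , st  = grow ⁅ v ⁆ (⊃-wellFounded _) (x∈⁅x⁆ v) (initial v)
        st′ , done = close-chords all st (allFin (m G))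
    in frank (State.core st′) (λ e → done e (∈-allFin e))

  frank-without-vertices : ¬ V → FrankNumber≤ G 5
  frank-without-vertices ¬V =
    (λ _ _ → true) , (λ _ x → contradiction x ¬V) , λ e → contradiction (src e) ¬V

inhabited? : ∀ k → Dec (Fin k)
inhabited? ℕ.zero    = no λ ()
inhabited? (ℕ.suc k) = yes zero

theorem3 : (G : Graph) → EdgeConnected 3 G → FrankNumber≤ G 5
theorem3 G conn with inhabited? (n G)
... | yes v = Frank.frank-from-vertex G conn v
... | no ¬V = Frank.frank-without-vertices G conn ¬V
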